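{- Let $n\ge 1$ be an integer and let $(a_1,\ldots,a_n)$ be an $n$-tuple of positive integers. Then $(a_1,\ldots,a_n)$ satisfies $M_n(a_1,\ldots,a_n)=\pm S$ (that is, $M_n(a_1,\ldots,a_n)\in\{S,-S\}$) if and only if $(a_1,\ldots,a_n)$ is the quiddity of a notched $3d$-dissection of a convex polygon with $n+1$ vertices.
   Context: For integers $a_1,\ldots,a_n$ put $$M_n(a_1,\ldots,a_n)=\begin{pmatrix} a_n & -1\\ 1 & 0\end{pmatrix}\begin{pmatrix} a_{n-1} & -1\\ 1 & 0\end{pmatrix}\cdots\begin{pmatrix} a_1 & -1\\ 1 & 0\end{pmatrix}\in SL_2(\mathbb{Z}),\qquad S=\begin{pmatrix} 0 & -1\\ 1 & 0\end{pmatrix}.$$ Notched $3d$-dissection (French: 3$d$-dissection échancrée). Let $n\ge 5$ and let $P$ be a convex polygon with $n+1$ vertices. A notched $3d$-dissection of $P$ is a decomposition of $P$ into sub-polygons by diagonals of $P$ that cross only at vertices of $P$, such that: (1) exactly one of the sub-polygons is a quadrilateral; (2) every other sub-polygon of the decomposition has a number of vertices that is a multiple of $3$; (3) the quadrilateral has exactly two of its sides that are sides of $P$, and these two sides have a vertex in common. This common vertex is numbered $0$, and the other vertices of $P$ are then numbered $1,2,\ldots,n$ in counterclockwise order. For $1\le i\le n$, let $a_i$ be the number of sub-polygons whose number of vertices is a multiple of $3$ and which have vertex $i$ as one of their vertices. The sequence $(a_1,\ldots,a_n)$ is the quiddity of the notched $3d$-dissection. (For $n<5$ there are no notched $3d$-dissections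 of a polygon with $n+1$ vertices.) -}

module Defs where

open import Data.Bool.Base using (true; false)
open import Data.Fin.Base using (Fin; zero; suc; _≤_; _<_)
open import Data.Fin.Properties using (_≟_; _≤?_; _<?_; all?)
open import Data.Fin.Subset using (Subset; _∈_; ∣_∣; ⊤)
open import Data.Fin.Subset.Properties using (_∈?_)
open import Data.Integer.Base as ℤ using (ℤ; +_; 0ℤ; 1ℤ; -1ℤ)
open import Data.List.Base using (List; []; _∷_; _++_; map; filter; length)
import Data.List.Membership.DecPropositional as DecMembership
open import Data.Nat.Base as ℕ using (ℕ; zero; suc)
import Data.Nat.Properties as ℕ
open import Data.Nat.Divisibility using (_∣_; _∣?_)
open import Data.Product using (_×_; _,_; ∃-syntax)
open import Data.Product.Properties using (≡-dec)
open import Data.Sum using (_⊎_)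
open import Data.Vec.Base using (Vec; []; _∷_; lookup)
open import Relation.Binary.PropositionalEquality using (_≡_; _≢_)
open import Relation.Nullary using (¬_; Dec)
open import Relation.Nullary.Decidable using (_×-dec_; _⊎-dec_; _→-dec_)

-- ⟦ a , b ⨾ c , d ⟧ has first row (a b) and second row (c d).
record Mat₂ : Set where
  constructor ⟦_,_⨾_,_⟧
  field
    e₁₁ e₁₂ e₂₁ e₂₂ : ℤ

infixl 7 _·_
infix  8 -ᴹ_

_·_ : Mat₂ → Mat₂ → Mat₂
⟦ a , b ⨾ c , d ⟧ · ⟦ a′ , b′ ⨾ c′ , d′ ⟧ =
  ⟦ a ℤ.* a′ ℤ.+ b ℤ.* c′ , a ℤ.* b′ ℤ.+ b ℤ.* d′
  ⨾ c ℤ.* a′ ℤ.+ d ℤ.* c′ , c ℤ.* b′ ℤ.+ d ℤ.* d′ ⟧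

-ᴹ_ : Mat₂ → Mat₂
-ᴹ ⟦ a , b ⨾ c , d ⟧ = ⟦ ℤ.- a , ℤ.- b ⨾ ℤ.- c , ℤ.- d ⟧

Id : Mat₂
Id = ⟦ 1ℤ , 0ℤ ⨾ 0ℤ , 1ℤ ⟧

S : Mat₂
S = ⟦ 0ℤ , -1ℤ ⨾ 1ℤ , 0ℤ ⟧

-- The head of the vector is a₁, whose matrix is the rightmost factor.
M : ∀ {n} → Vec ℤ n → Mat₂
M []       = Id
M (a ∷ as) = M as · ⟦ a , -1ℤ ⨾ 1ℤ , 0ℤ ⟧

-- The vertices of a convex N-gon P are numbered 0, …, N-1 in
-- counterclockwise order and identified with Fin N.  A convex polygon
-- whose vertices are vertices of P is given by its set of vertices
-- V : Subset N (and P itself by ⊤).  A segment joining two distinct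
-- vertices is given by the pair (x , y) of its endpoints with x < y.

-- [x, y] is a side of V: x and y are cyclically consecutive in V, i.e.
-- no vertex of V lies strictly between them on one of the two arcs.
IsSide : ∀ {N} → Subset N → Fin N → Fin N → Set
IsSide V x y = x < y × x ∈ V × y ∈ V ×
  ((∀ z → z ∈ V → z ≤ x ⊎ y ≤ z) ⊎ (∀ z → z ∈ V → x ≤ z × z ≤ y))

IsDiagonal : ∀ {N} → Fin N → Fin N → Set
IsDiagonal x y = x < y × ¬ IsSide ⊤ x y

module _ {N : ℕ} where
  open DecMembership (≡-dec (_≟_ {N}) (_≟_ {N})) public
    using () renaming (_∈_ to _∈ₗ_; _∈?_ to _∈ₗ?_)

-- A set of diagonals of P, of which no two cross in the interior of P.
-- Order and repetitions in the list are immaterial.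
record Dissection (N : ℕ) : Set where
  field
    diagonals   : List (Fin N × Fin N)
    areDiagonal : ∀ x y → (x , y) ∈ₗ diagonals → IsDiagonal x y
    nonCrossing : ∀ x y z w → (x , y) ∈ₗ diagonals → (z , w) ∈ₗ diagonals →
                  ¬ (x < z × z < y × y < w)

open Dissection public

-- V is one of the pieces into which the diagonals cut P: its sides are
-- sides of P or diagonals of the dissection, and no diagonal of the
-- dissection runs through its interior.  (By nonCrossing, a diagonal
-- meeting the interior of such a V has both endpoints in V.)
IsSubpolygon : ∀ {N} → Dissection N → Subset N → Set
IsSubpolygon D V =
  3 ℕ.≤ ∣ V ∣ ×
  (∀ x y → IsSide V x y → IsSide ⊤ x y ⊎ (x , y) ∈ₗ diagonals D) ×
  (∀ x y → (x , y) ∈ₗ diagonals D → x ∈ V → y ∈ V → IsSide V x y)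

isSide? : ∀ {N} (V : Subset N) x y → Dec (IsSide V x y)
isSide? V x y = (x <? y) ×-dec (x ∈? V) ×-dec (y ∈? V) ×-dec
  ((all? λ z → (z ∈? V) →-dec ((z ≤? x) ⊎-dec (y ≤? z))) ⊎-dec
   (all? λ z → (z ∈? V) →-dec ((x ≤? z) ×-dec (z ≤? y))))

isSubpolygon? : ∀ {N} (D : Dissection N) V → Dec (IsSubpolygon D V)
isSubpolygon? D V =
  (3 ℕ.≤? ∣ V ∣) ×-dec
  (all? λ x → all? λ y →
    isSide? V x y →-dec (isSide? ⊤ x y ⊎-dec ((x , y) ∈ₗ? diagonals D))) ×-dec
  (all? λ x → all? λ y →
    ((x , y) ∈ₗ? diagonals D) →-dec
      ((x ∈? V) →-dec ((y ∈? V) →-dec isSide? V x y)))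

-- All subsets of Fin N, each exactly once.
subsets : ∀ N → List (Subset N)
subsets zero    = [] ∷ []
subsets (suc N) = map (true ∷_) (subsets N) ++ map (false ∷_) (subsets N)

subpolygons : ∀ {N} → Dissection N → List (Subset N)
subpolygons D = filter (isSubpolygon? D) (subsets _)

count3d : ∀ {N} → Dissection N → Fin N → ℕ
count3d D i = length (filter (λ V → (3 ∣? ∣ V ∣) ×-dec (i ∈? V)) (subpolygons D))

-- Since pairs of endpoints are increasing, a side having vertex 0 as an
-- endpoint is of the form (zero , u).
record NotchedDissection (n : ℕ) : Set where
  field
    5≤n        : 5 ℕ.≤ n
    dissection : Dissection (suc n)

    quad        : Subset (suc n)
    quad-piece  : IsSubpolygon dissection quad
    quad-size   : ∣ quad ∣ ≡ 4
    quad-unique : ∀ V → IsSubpolygon dissection V → ∣ V ∣ ≡ 4 → V ≡ quad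

    others-3d : ∀ V → IsSubpolygon dissection V → V ≢ quad → 3 ∣ ∣ V ∣

    -- Exactly two sides of quad are sides of P, and they meet at vertex 0.
    notch : ∃[ u ] ∃[ v ] u ≢ v ×
      (IsSide quad zero u × IsSide ⊤ zero u) ×
      (IsSide quad zero v × IsSide ⊤ zero v) ×
      (∀ x y → IsSide quad x y → IsSide ⊤ x y →
        (x , y) ≡ (zero , u) ⊎ (x , y) ≡ (zero , v))

open NotchedDissection public

-- The i-th entry of a (from 0) is a_{i+1}, the value at vertex suc i.
IsQuiddityOf : ∀ {n} → Vec ℤ n → NotchedDissection n → Set
IsQuiddityOf a E = ∀ i → lookup a i ≡ + count3d (dissection E) (suc i)

{-# OPTIONS --safe #-}
module Submission where

-- Let T and S also denote the images in PSL₂(ℤ) of ⟦ 1 , 0 ⨾ -1 , 1 ⟧ and of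
-- the matrix S; they satisfy S² = (ST)³ = 1.  Up to sign, S · M(a) is the image
-- (with reversed products) of the word T^{a₁} S T^{a₂} S … S T^{aₙ}, so M(a) = ±S
-- exactly when this word is trivial.  Read along a polygon, the letter S moves to
-- the next vertex and T adds a piece at the current vertex.  A polygon rooted at
-- a side and cut into pieces whose numbers of vertices are multiples of 3 gives a
-- word equal to S, by collapsing the pieces with (ST)³ = 1; a notched
-- dissection is the quadrilateral with two such polygons glued to it, and its
-- word is S S = 1.  Conversely, reduce a trivial word greedily from left to
-- right, keeping a stack of unfinished pieces.  The pieces that remain unfinished
-- contribute a product of ⟦ 1 , 0 ⨾ -1 , 1 ⟧ and ⟦ 1 , -1 ⨾ 0 , 1 ⟧, which
-- is not ±1 unless it is empty, so the word splits into exactly two polygons.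

open import Data.Bool.Base using (true; false; if_then_else_)
import Data.Empty as Empty
open import Data.Empty using (⊥-elim)
open import Data.Fin.Base as Fin using (Fin; zero; suc; toℕ; fromℕ<)
open import Data.Fin.Properties using (toℕ<n; toℕ-injective; toℕ-fromℕ<; any?)
open import Data.Fin.Subset using (Subset; ∣_∣; ⊤; ⊥) renaming (_∈_ to _∈ˢ_; _∉_ to _∉ˢ_)
open import Data.Fin.Subset.Properties using (_∈?_; ∈⊤; ∉⊥; ∣⊥∣≡0; p⊆q⇒∣p∣≤∣q∣; ⊆-antisym)
open import Data.Integer.Base using (ℤ; 0ℤ; _<_)
open import Data.Integer.Base as ℤ using (+_; 1ℤ; -1ℤ)
import Data.Integer.Properties as ℤ
open import Data.Integer.Tactic.RingSolver using (solve-∀)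
open import Data.List.Base using (List; []; _∷_; _++_; _∷ʳ_; length; map; filter)
open import Data.List.Membership.DecPropositional using () renaming (_∈?_ to member?)
open import Data.List.Membership.Propositional using (_∈_; _∉_)
open import Data.List.Membership.Propositional.Properties
  using (∈-++⁻; ∈-++⁺ˡ; ∈-++⁺ʳ; ∈-map⁺; ∈-map⁻; ∈-filter⁺; ∈-filter⁻)
open import Data.List.Membership.Propositional.Properties.WithK using (unique∧set⇒bag)
open import Data.List.Properties using (++-assoc; ++-identityʳ; length-++; filter-++; filter-reject)
open import Data.List.Relation.Binary.BagAndSetEquality using (∼bag⇒↭)
open import Data.List.Relation.Binary.Permutation.Propositional using (_↭_)
open import Data.List.Relation.Binary.Permutation.Propositional.Properties using (filter-↭; ↭-length)
open import Data.List.Relation.Unary.All as All using (All; []; _∷_)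
open import Data.List.Relation.Unary.All.Properties using (∷ʳ⁺)
open import Data.List.Relation.Unary.AllPairs using (AllPairs; []; _∷_)
import Data.List.Relation.Unary.AllPairs.Properties as AllPairs
open import Data.List.Relation.Unary.Any using (here; there)
open import Data.List.Relation.Unary.Unique.Propositional using (Unique)
open import Data.List.Relation.Unary.Unique.Propositional.Properties using (map⁺; ++⁺; filter⁺)
open import Data.Nat.Base using (ℕ; _≥_)
open import Data.Nat.Base as ℕ using (zero; suc; _+_; _≤_; z≤n; s≤s)
open import Data.Nat.Divisibility using (_∣_; _∣?_; ∣m+n∣m⇒∣n; ∣m∣n⇒∣m+n; ∣-refl; ∣⇒≤)
import Data.Nat.Properties as ℕ
import Data.Nat.Tactic.RingSolver as ℕ-Solver
open import Data.Product using (Σ-syntax)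
open import Data.Product using (_×_; _,_; proj₁; proj₂; ∃-syntax)
open import Data.Sum using (_⊎_)
open import Data.Sum as Sum using (inj₁; inj₂)
open import Data.Vec.Base using (Vec; lookup)
open import Data.Vec.Base using ([]; _∷_; here; there)
open import Data.Vec.Properties using (∷-injective)
open import Function.Base using (_∘_)
open import Function.Bundles using (_⇔_)
open import Function.Bundles using (mk⇔; Equivalence)
open import Level using (0ℓ)
open import Relation.Binary.PropositionalEquality using (_≡_)
open import Relation.Binary.PropositionalEquality hiding (_≡_)
open import Relation.Nullary using (¬_; Dec; yes; no; does)
open import Relation.Nullary.Decidable using (_×-dec_; _⊎-dec_; ¬?; from-no; dec-true; dec-false)
open import Relation.Unary using (Pred; Decidable)
open import Defs

-- The obstacle on the geometric side is that `IsSubpolygon` and `count3d` speak of arbitrary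
-- subsets of `Fin N`, while matrices only see words. Trees mediate: a piece is identified by the
-- interval that its base cuts off, and descent in the tree is inclusion of intervals. With the side
-- [0, n] as root side, the quadrilateral of a notched dissection is the root, with subtrees over
-- [0, 1], [1, j] and [j, n]. The first is a leaf, so vertex 0, which has no entry, drops out and
-- the word starts at vertex 1. On the algebraic side, a node with k subtrees collapses to `T`, `U`
-- or `S` according to k modulo 3. Conjugation by diag(1, -1) makes `T` and `U` elementary matrices
-- with nonnegative entries, so their products only grow and never cancel. Greedy closing leaves no
-- complete piece except perhaps the lowest and the innermost, so `S` can survive only at the two
-- ends of the product, and S X S = ±1 forces the middle part X to be empty.

-- Dissected polygons as trees

-- A polygon with vertices x, x+1, …, y, dissected and rooted at the side
-- [x, y], is a tree: a leaf if y = x+1, and otherwise a node with one child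
-- for each side other than [x, y] of the piece lying along [x, y].
data Tree : Set where
  leaf : Tree
  node : List Tree → Tree

end  : ℕ → Tree → ℕ
end* : ℕ → List Tree → ℕ
end x leaf        = suc x
end x (node ts)   = end* x ts
end* x []         = x
end* x (t ∷ ts)   = end* (end x t) ts

-- A piece of the dissection: its first vertex and its subtrees.
Piece : Set
Piece = ℕ × List Tree

left right : Piece → ℕ
left  (x , ts) = x
right (x , ts) = end* x ts

pieces  : ℕ → Tree → List Piece
pieces* : ℕ → List Tree → List Piece
pieces x leaf        = []
pieces x (node ts)   = (x , ts) ∷ pieces* x ts
pieces* x []         = []
pieces* x (t ∷ ts)   = pieces x t ++ pieces* (end x t) ts

corners : ℕ → List Tree → List ℕ
corners x []     = x ∷ []
corners x (t ∷ ts) = x ∷ corners (end x t) ts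

data Every (P : ℕ → Set) : Tree → Set where
  leaf : Every P leaf
  node : ∀ {ts} → P (length ts) → All (Every P) ts → Every P (node ts)

-- `Tree` also admits nodes with no subtree or just one, which bound no polygon. Requiring two makes
-- `end` strictly increasing and every base at least two long.
Branching : Tree → Set
Branching = Every (2 ≤_)

Every-map : ∀ {P Q : ℕ → Set} → (∀ {k} → P k → Q k) → ∀ {t} → Every P t → Every Q t
Every-map* : ∀ {P Q : ℕ → Set} → (∀ {k} → P k → Q k) → ∀ {ts} → All (Every P) ts → All (Every Q) ts
Every-map f leaf        = leaf
Every-map f (node p ps) = node (f p) (Every-map* f ps)
Every-map* f []         = []
Every-map* f (p ∷ ps)   = Every-map f p ∷ Every-map* f ps

pieces-Every : ∀ {P : ℕ → Set} {t} x {o} → Every P t → o ∈ pieces x t → P (length (proj₂ o))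
pieces*-Every : ∀ {P : ℕ → Set} {ts} x {o} → All (Every P) ts → o ∈ pieces* x ts → P (length (proj₂ o))
pieces-Every x (node p ps) (here refl) = p
pieces-Every x (node p ps) (there o∈)  = pieces*-Every x ps o∈
pieces*-Every {ts = t ∷ ts} x (p ∷ ps) o∈ with ∈-++⁻ (pieces x t) o∈
... | inj₁ o∈t  = pieces-Every x p o∈t
... | inj₂ o∈ts = pieces*-Every (end x t) ps o∈ts

subtrees-Every  : ∀ {P : ℕ → Set} {t} x {o} → Every P t → o ∈ pieces x t → All (Every P) (proj₂ o)
subtrees*-Every : ∀ {P : ℕ → Set} {ts} x {o} → All (Every P) ts → o ∈ pieces* x ts → All (Every P) (proj₂ o)
subtrees-Every x (node p ps) (here refl) = ps
subtrees-Every x (node p ps) (there o∈)  = subtrees*-Every x ps o∈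
subtrees*-Every {ts = t ∷ ts} x (p ∷ ps) o∈ with ∈-++⁻ (pieces x t) o∈
... | inj₁ o∈t  = subtrees-Every x p o∈t
... | inj₂ o∈ts = subtrees*-Every (end x t) ps o∈ts

<-end  : ∀ x {t} → Branching t → x ℕ.< end x t
≤-end* : ∀ x {ts} → All Branching ts → x ≤ end* x ts
<-end x leaf                      = ℕ.≤-refl
<-end x (node {[]} () _)
<-end x (node {t ∷ ts} _ (p ∷ ps)) = ℕ.<-≤-trans (<-end x p) (≤-end* (end x t) ps)
≤-end* x []                       = ℕ.≤-refl
≤-end* x {t ∷ ts} (p ∷ ps)        = ℕ.≤-trans (ℕ.<⇒≤ (<-end x p)) (≤-end* (end x t) ps)

<-end* : ∀ x {ts} → 2 ≤ length ts → All Branching ts → suc x ℕ.< end* x ts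
<-end* x {t ∷ []} (s≤s ()) ps
<-end* x {t ∷ t′ ∷ ts} _ (p ∷ p′ ∷ ps) =
  ℕ.<-≤-trans (ℕ.≤-<-trans (<-end x p) (<-end (end x t) p′)) (≤-end* _ ps)

pieces-bounds : ∀ x {t o} → Branching t → o ∈ pieces x t →
  x ≤ left o × suc (left o) ℕ.< right o × right o ≤ end x t
pieces*-bounds : ∀ x {ts o} → All Branching ts → o ∈ pieces* x ts →
  x ≤ left o × suc (left o) ℕ.< right o × right o ≤ end* x ts
pieces-bounds x (node p ps) (here refl) = ℕ.≤-refl , <-end* x p ps , ℕ.≤-refl
pieces-bounds x (node p ps) (there o∈)  = pieces*-bounds x ps o∈
pieces*-bounds x {t ∷ ts} (p ∷ ps) o∈ with ∈-++⁻ (pieces x t) o∈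
... | inj₁ o∈t with pieces-bounds x p o∈t
...   | x≤ , l<r , ≤e = x≤ , l<r , ℕ.≤-trans ≤e (≤-end* _ ps)
pieces*-bounds x {t ∷ ts} (p ∷ ps) o∈ | inj₂ o∈ts with pieces*-bounds (end x t) ps o∈ts
...   | x≤ , l<r , ≤e = ℕ.≤-trans (ℕ.<⇒≤ (<-end x p)) x≤ , l<r , ≤e

-- A piece below lies inside one subtree, and each of the two or more subtrees takes up some of the
-- interval. This tells a node from its descendants by the base alone.
pieces*-proper : ∀ x {ts o} → 2 ≤ length ts → All Branching ts → o ∈ pieces* x ts →
  ¬ (left o ≤ x × end* x ts ≤ right o)
pieces*-proper x {t ∷ []} (s≤s ())
pieces*-proper x {t ∷ t′ ∷ ts} _ (p ∷ p′ ∷ ps) o∈ (l≤ , ≤r) with ∈-++⁻ (pieces x t) o∈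
... | inj₁ o∈t  = ℕ.<⇒≱ (ℕ.<-≤-trans (<-end (end x t) p′) (≤-end* _ ps))
                    (ℕ.≤-trans ≤r (proj₂ (proj₂ (pieces-bounds x p o∈t))))
... | inj₂ o∈ts = ℕ.<⇒≱ (<-end x p)
                    (ℕ.≤-trans (proj₁ (pieces*-bounds (end x t) (p′ ∷ ps) o∈ts)) l≤)

-- Bases from different subtrees share at most an endpoint, while a base is at least two long; so
-- inclusion of bases occurs only along a branch of the tree.
pieces-nested : ∀ x {t o o′} → Branching t → o ∈ pieces x t → o′ ∈ pieces x t →
  left o ≤ left o′ → right o′ ≤ right o → o′ ≡ o ⊎ o′ ∈ pieces* (left o) (proj₂ o)
pieces*-nested : ∀ x {ts o o′} → All Branching ts → o ∈ pieces* x ts → o′ ∈ pieces* x ts →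
  left o ≤ left o′ → right o′ ≤ right o → o′ ≡ o ⊎ o′ ∈ pieces* (left o) (proj₂ o)
pieces-nested x (node _ _)  (here refl) (here refl) l r = inj₁ refl
pieces-nested x (node _ _)  (here refl) (there o′∈) l r = inj₂ o′∈
pieces-nested x (node p ps) (there o∈)  (here refl) l r = ⊥-elim (pieces*-proper x p ps o∈ (l , r))
pieces-nested x (node p ps) (there o∈)  (there o′∈) l r = pieces*-nested x ps o∈ o′∈ l r
pieces*-nested x {t ∷ ts} (p ∷ ps) o∈ o′∈ l r
  with ∈-++⁻ (pieces x t) o∈ | ∈-++⁻ (pieces x t) o′∈
... | inj₁ o∈t  | inj₁ o′∈t  = pieces-nested x p o∈t o′∈t l r
... | inj₂ o∈ts | inj₂ o′∈ts = pieces*-nested (end x t) ps o∈ts o′∈ts l r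
... | inj₁ o∈t  | inj₂ o′∈ts
    with pieces-bounds x p o∈t | pieces*-bounds (end x t) ps o′∈ts
...   | _ , _ , re | el , lr , _ =
        ⊥-elim (ℕ.<-irrefl refl (ℕ.≤-<-trans el (ℕ.<-≤-trans (ℕ.<-trans (ℕ.n<1+n _) lr) (ℕ.≤-trans r re))))
pieces*-nested x {t ∷ ts} (p ∷ ps) o∈ o′∈ l r | inj₂ o∈ts | inj₁ o′∈t
    with pieces*-bounds (end x t) ps o∈ts | pieces-bounds x p o′∈t
...   | el , _ , _ | _ , lr , re =
        ⊥-elim (ℕ.<-irrefl refl (ℕ.≤-<-trans el (ℕ.≤-<-trans l (ℕ.<-≤-trans (ℕ.<-trans (ℕ.n<1+n _) lr) re))))

Crossing : Piece → Piece → Set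
Crossing o o′ = left o ℕ.< left o′ × left o′ ℕ.< right o × right o ℕ.< right o′

pieces-¬crossing : ∀ x {t o o′} → Branching t → o ∈ pieces x t → o′ ∈ pieces x t → ¬ Crossing o o′
pieces*-¬crossing : ∀ x {ts o o′} → All Branching ts → o ∈ pieces* x ts → o′ ∈ pieces* x ts → ¬ Crossing o o′
pieces-¬crossing x (node _ _) (here refl) (here refl) (c , _) = ℕ.<-irrefl refl c
pieces-¬crossing x (node p ps) (here refl) (there o′∈) (_ , _ , c) =
  ℕ.<⇒≱ c (proj₂ (proj₂ (pieces*-bounds x ps o′∈)))
pieces-¬crossing x (node p ps) (there o∈) (here refl) (c , _) =
  ℕ.<⇒≱ c (proj₁ (pieces*-bounds x ps o∈))
pieces-¬crossing x (node p ps) (there o∈) (there o′∈) c = pieces*-¬crossing x ps o∈ o′∈ c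
pieces*-¬crossing x {t ∷ ts} (p ∷ ps) o∈ o′∈ c@(c₁ , c₂ , c₃)
  with ∈-++⁻ (pieces x t) o∈ | ∈-++⁻ (pieces x t) o′∈
... | inj₁ o∈t  | inj₁ o′∈t  = pieces-¬crossing x p o∈t o′∈t c
... | inj₂ o∈ts | inj₂ o′∈ts = pieces*-¬crossing (end x t) ps o∈ts o′∈ts c
... | inj₁ o∈t  | inj₂ o′∈ts =
  ℕ.<⇒≱ (ℕ.<-≤-trans c₂ (proj₂ (proj₂ (pieces-bounds x p o∈t)))) (proj₁ (pieces*-bounds (end x t) ps o′∈ts))
... | inj₂ o∈ts | inj₁ o′∈t  =
  ℕ.<⇒≱ (ℕ.<-≤-trans (ℕ.<-trans c₂ c₃) (proj₂ (proj₂ (pieces-bounds x p o′∈t))))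
    (ℕ.≤-trans (proj₁ (pieces*-bounds (end x t) ps o∈ts)) (ℕ.<⇒≤ c₁))

corners-bounds : ∀ x {ts z} → All Branching ts → z ∈ corners x ts → x ≤ z × z ≤ end* x ts
corners-bounds x {[]}     []       (here refl) = ℕ.≤-refl , ℕ.≤-refl
corners-bounds x {t ∷ ts} (p ∷ ps) (here refl) = ℕ.≤-refl , ≤-end* x (p ∷ ps)
corners-bounds x {t ∷ ts} (p ∷ ps) (there z∈) with corners-bounds (end x t) ps z∈
... | l , r = ℕ.≤-trans (ℕ.<⇒≤ (<-end x p)) l , r

left∈corners : ∀ x ts → x ∈ corners x ts
left∈corners x []     = here refl
left∈corners x (t ∷ ts) = here refl

right∈corners : ∀ x ts → end* x ts ∈ corners x ts
right∈corners x []     = here refl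
right∈corners x (t ∷ ts) = there (right∈corners (end x t) ts)

-- With `corner-or-covered`: within the interval, the corners are the vertices strictly under no
-- base of a piece below. This describes corners by diagonals alone, the form in which they can be
-- compared with `IsSubpolygon`.
corners-uncovered : ∀ x {ts o z} → All Branching ts → o ∈ pieces* x ts → z ∈ corners x ts →
  z ≤ left o ⊎ right o ≤ z
corners-uncovered x {t ∷ ts} ps o∈ (here refl) = inj₁ (proj₁ (pieces*-bounds x ps o∈))
corners-uncovered x {t ∷ ts} (p ∷ ps) o∈ (there z∈) with ∈-++⁻ (pieces x t) o∈
... | inj₁ o∈t  = inj₂ (ℕ.≤-trans (proj₂ (proj₂ (pieces-bounds x p o∈t))) (proj₁ (corners-bounds (end x t) ps z∈)))
... | inj₂ o∈ts = corners-uncovered (end x t) ps o∈ts z∈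

corner-or-covered : ∀ x {ts z} → x ≤ z → z ≤ end* x ts →
  z ∈ corners x ts ⊎ ∃[ o ] (o ∈ pieces* x ts × left o ℕ.< z × z ℕ.< right o)
corner-or-covered x {[]} x≤ ≤x = inj₁ (here (ℕ.≤-antisym ≤x x≤))
corner-or-covered x {t ∷ ts} {z} x≤ ≤e with ℕ.m≤n⇒m<n∨m≡n x≤
... | inj₂ refl = inj₁ (here refl)
... | inj₁ x<z with z ℕ.<? end x t
corner-or-covered x {leaf ∷ ts} x≤ ≤e | inj₁ x<z | yes z< = ⊥-elim (ℕ.<⇒≱ x<z (ℕ.≤-pred z<))
corner-or-covered x {node us ∷ ts} x≤ ≤e | inj₁ x<z | yes z< = inj₂ ((x , us) , here refl , x<z , z<)
corner-or-covered x {t ∷ ts} x≤ ≤e | inj₁ x<z | no z≮ with corner-or-covered (end x t) {ts} (ℕ.≮⇒≥ z≮) ≤e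
... | inj₁ z∈ = inj₁ (there z∈)
... | inj₂ (o , o∈ , c) = inj₂ (o , ∈-++⁺ʳ (pieces x t) o∈ , c)

-- Consecutive corners are the two ends of one subtree, which is either a leaf or a node based
-- there.
corners-consecutive : ∀ x {ts u v} → All Branching ts → u ∈ corners x ts → v ∈ corners x ts → u ℕ.< v →
  (∀ z → z ∈ corners x ts → z ≤ u ⊎ v ≤ z) →
  v ≡ suc u ⊎ ∃[ o ] (o ∈ pieces* x ts × left o ≡ u × right o ≡ v)
corners-consecutive x {[]} [] (here refl) (here refl) u<v gap = ⊥-elim (ℕ.<-irrefl refl u<v)
corners-consecutive x {t ∷ ts} ps (here refl) (here refl) u<v gap = ⊥-elim (ℕ.<-irrefl refl u<v)
corners-consecutive x {t ∷ ts} (p ∷ ps) (there u∈) (here refl) u<v gap =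
  ⊥-elim (ℕ.<⇒≱ u<v (ℕ.≤-trans (ℕ.<⇒≤ (<-end x p)) (proj₁ (corners-bounds (end x t) ps u∈))))
corners-consecutive x {t ∷ ts} (p ∷ ps) (there u∈) (there v∈) u<v gap
  with corners-consecutive (end x t) ps u∈ v∈ u<v (λ z z∈ → gap z (there z∈))
... | inj₁ eq = inj₁ eq
... | inj₂ (o , o∈ , eqs) = inj₂ (o , ∈-++⁺ʳ (pieces x t) o∈ , eqs)
corners-consecutive x {t ∷ ts} {u} {v} (p ∷ ps) (here refl) (there v∈) u<v gap
  with gap (end x t) (there (left∈corners (end x t) ts))
... | inj₁ e≤x = ⊥-elim (ℕ.<⇒≱ (<-end x p) e≤x)
... | inj₂ v≤e with ℕ.≤-antisym v≤e (proj₁ (corners-bounds (end x t) ps v∈))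
corners-consecutive x {leaf ∷ ts} (p ∷ ps) (here refl) (there v∈) u<v gap | inj₂ v≤e | refl = inj₁ refl
corners-consecutive x {node us ∷ ts} (p ∷ ps) (here refl) (there v∈) u<v gap | inj₂ v≤e | refl =
  inj₂ ((x , us) , here refl , refl , refl)

-- Words in PSL₂(ℤ)

mat-≡ : ∀ {a b c d a′ b′ c′ d′} → a ≡ a′ → b ≡ b′ → c ≡ c′ → d ≡ d′ → ⟦ a , b ⨾ c , d ⟧ ≡ ⟦ a′ , b′ ⨾ c′ , d′ ⟧
mat-≡ refl refl refl refl = refl

·-assoc : ∀ A B C → A · B · C ≡ A · (B · C)
·-assoc ⟦ a , b ⨾ c , d ⟧ ⟦ a′ , b′ ⨾ c′ , d′ ⟧ ⟦ a″ , b″ ⨾ c″ , d″ ⟧ =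
  mat-≡ (eq a b a′ b′ c′ d′ a″ c″) (eq a b a′ b′ c′ d′ b″ d″) (eq c d a′ b′ c′ d′ a″ c″) (eq c d a′ b′ c′ d′ b″ d″)
  where
  eq : ∀ a b a′ b′ c′ d′ x y → (a ℤ.* a′ ℤ.+ b ℤ.* c′) ℤ.* x ℤ.+ (a ℤ.* b′ ℤ.+ b ℤ.* d′) ℤ.* y ≡
       a ℤ.* (a′ ℤ.* x ℤ.+ b′ ℤ.* y) ℤ.+ b ℤ.* (c′ ℤ.* x ℤ.+ d′ ℤ.* y)
  eq = solve-∀

·-identityʳ : ∀ A → A · Id ≡ A
·-identityʳ ⟦ a , b ⨾ c , d ⟧ = mat-≡ (eq₁ a b) (eq₂ a b) (eq₁ c d) (eq₂ c d)
  where
  eq₁ : ∀ x y → x ℤ.* 1ℤ ℤ.+ y ℤ.* 0ℤ ≡ x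
  eq₁ = solve-∀
  eq₂ : ∀ x y → x ℤ.* 0ℤ ℤ.+ y ℤ.* 1ℤ ≡ y
  eq₂ = solve-∀

·-identityˡ : ∀ A → Id · A ≡ A
·-identityˡ ⟦ a , b ⨾ c , d ⟧ = mat-≡ (eq₁ a c) (eq₁ b d) (eq₂ a c) (eq₂ b d)
  where
  eq₁ : ∀ x y → 1ℤ ℤ.* x ℤ.+ 0ℤ ℤ.* y ≡ x
  eq₁ = solve-∀
  eq₂ : ∀ x y → 0ℤ ℤ.* x ℤ.+ 1ℤ ℤ.* y ≡ y
  eq₂ = solve-∀

-‿·ˡ : ∀ A B → (-ᴹ A) · B ≡ -ᴹ (A · B)
-‿·ˡ ⟦ a , b ⨾ c , d ⟧ ⟦ a′ , b′ ⨾ c′ , d′ ⟧ = mat-≡ (eq a b a′ c′) (eq a b b′ d′) (eq c d a′ c′) (eq c d b′ d′)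
  where
  eq : ∀ a b x y → (ℤ.- a) ℤ.* x ℤ.+ (ℤ.- b) ℤ.* y ≡ ℤ.- (a ℤ.* x ℤ.+ b ℤ.* y)
  eq = solve-∀

-‿·ʳ : ∀ A B → A · (-ᴹ B) ≡ -ᴹ (A · B)
-‿·ʳ ⟦ a , b ⨾ c , d ⟧ ⟦ a′ , b′ ⨾ c′ , d′ ⟧ = mat-≡ (eq a b a′ c′) (eq a b b′ d′) (eq c d a′ c′) (eq c d b′ d′)
  where
  eq : ∀ a b x y → a ℤ.* (ℤ.- x) ℤ.+ b ℤ.* (ℤ.- y) ≡ ℤ.- (a ℤ.* x ℤ.+ b ℤ.* y)
  eq = solve-∀

-ᴹ-involutive : ∀ A → -ᴹ (-ᴹ A) ≡ A
-ᴹ-involutive ⟦ a , b ⨾ c , d ⟧ =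
  mat-≡ (ℤ.neg-involutive a) (ℤ.neg-involutive b) (ℤ.neg-involutive c) (ℤ.neg-involutive d)

infix 4 _≈_

-- Equality in PSL₂(ℤ).
_≈_ : Mat₂ → Mat₂ → Set
A ≈ B = A ≡ B ⊎ A ≡ -ᴹ B

≈-refl : ∀ {A} → A ≈ A
≈-refl = inj₁ refl

≈-sym : ∀ {A B} → A ≈ B → B ≈ A
≈-sym (inj₁ refl)     = inj₁ refl
≈-sym {B = B} (inj₂ refl) = inj₂ (sym (-ᴹ-involutive B))

≈-trans : ∀ {A B C} → A ≈ B → B ≈ C → A ≈ C
≈-trans (inj₁ refl) q           = q
≈-trans (inj₂ refl) (inj₁ refl) = inj₂ refl
≈-trans {C = C} (inj₂ refl) (inj₂ refl) = inj₁ (-ᴹ-involutive C)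

·-cong-≈ : ∀ {A A′ B B′} → A ≈ A′ → B ≈ B′ → A · B ≈ A′ · B′
·-cong-≈ (inj₁ refl) (inj₁ refl) = inj₁ refl
·-cong-≈ {A} {B′ = B′} (inj₁ refl) (inj₂ refl) = inj₂ (-‿·ʳ A B′)
·-cong-≈ {A′ = A′} {B} (inj₂ refl) (inj₁ refl) = inj₂ (-‿·ˡ A′ B)
·-cong-≈ {A′ = A′} {B′ = B′} (inj₂ refl) (inj₂ refl) =
  inj₁ (trans (-‿·ˡ A′ (-ᴹ B′)) (trans (cong -ᴹ_ (-‿·ʳ A′ B′)) (-ᴹ-involutive (A′ · B′))))

-- The word tick^{a₁} step tick^{a₂} step … tick^{aₙ} encodes (a₁, …, aₙ).
-- Sequences glued by adding the last entry of one to the first entry of the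
-- next then correspond to concatenated words.
data Letter : Set where
  tick step : Letter

Word : Set
Word = List Letter

-- Each node puts one `tick` at each of its corners, so the ticks at a vertex count the pieces
-- having it as a corner.
word  : Tree → Word
word* : List Tree → Word
word leaf        = step ∷ []
word (node ts)   = word* ts
word* []         = tick ∷ []
word* (t ∷ ts)   = tick ∷ word t ++ word* ts

T U : Mat₂
T = ⟦ 1ℤ , 0ℤ ⨾ -1ℤ , 1ℤ ⟧
U = ⟦ 1ℤ , -1ℤ ⨾ 0ℤ , 1ℤ ⟧

φ : Word → Mat₂
φ []         = Id
φ (tick ∷ w) = φ w · T
φ (step ∷ w) = φ w · S

φ-++ : ∀ v w → φ (v ++ w) ≡ φ w · φ v
φ-++ [] w         = sym (·-identityʳ (φ w))
φ-++ (tick ∷ v) w = trans (cong (_· T) (φ-++ v w)) (·-assoc (φ w) (φ v) T)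
φ-++ (step ∷ v) w = trans (cong (_· S) (φ-++ v w)) (·-assoc (φ w) (φ v) S)

-- The matrix of a node with `k` subtrees once every subtree has collapsed to `S`. Up to sign it is
-- `T`, `U`, `S` for k congruent to 0, 1, 2 modulo 3.
G : ℕ → Mat₂
G zero    = T
G (suc k) = G k · S · T

G-3+ : ∀ k → G (3 ℕ.+ k) ≈ G k
G-3+ k = inj₂ (trans (cong (λ X → X · S · T) (step₂ (G k)))
                (trans (step₁ (G k · ((S · T) · (S · T))))
                (trans (·-assoc (G k) _ (S · T))
                -- The cube of `S · T` computes to `-ᴹ Id`.
                (trans (-‿·ʳ (G k) Id) (cong -ᴹ_ (·-identityʳ (G k)))))))
  where
  step₁ : ∀ X → X · S · T ≡ X · (S · T)
  step₁ X = ·-assoc X S T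
  step₂ : ∀ X → X · S · T · S · T ≡ X · ((S · T) · (S · T))
  step₂ X = trans (step₁ (X · S · T)) (trans (cong (_· (S · T)) (step₁ X)) (·-assoc X (S · T) (S · T)))

-- A piece with k subtrees has k + 1 vertices.
Ternary : ℕ → Set
Ternary k = 3 ∣ suc k

Complete Incomplete : ℕ → Set
Complete k   = Ternary k × G k ≈ S
Incomplete k = ¬ Ternary k × (G k ≈ T ⊎ G k ≈ U)

ternary-3+ : ∀ {k} → Ternary k → Ternary (3 ℕ.+ k)
ternary-3+ d = ∣m∣n⇒∣m+n ∣-refl d

ternary-3+⁻ : ∀ {k} → Ternary (3 ℕ.+ k) → Ternary k
ternary-3+⁻ d = ∣m+n∣m⇒∣n d ∣-refl

complete-3+ : ∀ k → Complete k → Complete (3 ℕ.+ k)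
complete-3+ k (d , e) = ternary-3+ d , ≈-trans (G-3+ k) e

incomplete-3+ : ∀ k → Incomplete k → Incomplete (3 ℕ.+ k)
incomplete-3+ k (¬d , inj₁ e) = (λ d → ¬d (ternary-3+⁻ d)) , inj₁ (≈-trans (G-3+ k) e)
incomplete-3+ k (¬d , inj₂ e) = (λ d → ¬d (ternary-3+⁻ d)) , inj₂ (≈-trans (G-3+ k) e)

¬ternary-<2 : ∀ {k} → k ℕ.< 2 → ¬ Ternary k
¬ternary-<2 k<2 d = ℕ.<⇒≱ k<2 (ℕ.≤-pred (∣⇒≤ d))

G-cases : ∀ k → Complete k ⊎ Incomplete k
G-cases 0 = inj₂ (¬ternary-<2 (s≤s z≤n) , inj₁ ≈-refl)
G-cases 1 = inj₂ (¬ternary-<2 (s≤s (s≤s z≤n)) , inj₂ ≈-refl)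
G-cases 2 = inj₁ (∣-refl , ≈-refl)
G-cases (suc (suc (suc k))) = Sum.map (complete-3+ k) (incomplete-3+ k) (G-cases k)

G-ternary : ∀ {k} → Ternary k → G k ≈ S
G-ternary {k} d with G-cases k
... | inj₁ (_ , e)  = e
... | inj₂ (¬d , _) = ⊥-elim (¬d d)

ternary⇒2≤ : ∀ {k} → Ternary k → 2 ≤ k
ternary⇒2≤ d = ℕ.≤-pred (∣⇒≤ d)

φ-tree  : ∀ {t} → Every Ternary t → φ (word t) ≈ S
φ-tree* : ∀ {ts} → All (Every Ternary) ts → φ (word* ts) ≈ G (length ts)
φ-tree leaf        = inj₁ refl
φ-tree (node d ps) = ≈-trans (φ-tree* ps) (G-ternary d)
φ-tree* []         = inj₁ refl
φ-tree* {t ∷ ts} (p ∷ ps) rewrite φ-++ (word t) (word* ts) =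
  ·-cong-≈ (·-cong-≈ (φ-tree* ps) (φ-tree p)) (≈-refl {T})

-- The monoid generated by `T` and `U`

private
  l₁ : ∀ x y → 1ℤ ℤ.* x ℤ.+ 0ℤ ℤ.* y ≡ x
  l₁ = solve-∀
  l₂ : ∀ x y → 0ℤ ℤ.* x ℤ.+ 1ℤ ℤ.* y ≡ y
  l₂ = solve-∀
  l₃ : ∀ x y → -1ℤ ℤ.* x ℤ.+ 1ℤ ℤ.* y ≡ (ℤ.- x) ℤ.+ y
  l₃ = solve-∀
  l₄ : ∀ x y → 1ℤ ℤ.* x ℤ.+ -1ℤ ℤ.* y ≡ x ℤ.+ ℤ.- y
  l₄ = solve-∀
  l₅ : ∀ x y → 0ℤ ℤ.* x ℤ.+ -1ℤ ℤ.* y ≡ ℤ.- y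
  l₅ = solve-∀
  r₁ : ∀ x y → x ℤ.* 1ℤ ℤ.+ y ℤ.* 0ℤ ≡ x
  r₁ = solve-∀
  r₂ : ∀ x y → x ℤ.* 0ℤ ℤ.+ y ℤ.* 1ℤ ≡ y
  r₂ = solve-∀
  r₃ : ∀ x y → x ℤ.* 1ℤ ℤ.+ y ℤ.* -1ℤ ≡ x ℤ.+ ℤ.- y
  r₃ = solve-∀
  r₄ : ∀ x y → x ℤ.* -1ℤ ℤ.+ y ℤ.* 1ℤ ≡ ℤ.- x ℤ.+ y
  r₄ = solve-∀
  r₅ : ∀ x y → x ℤ.* -1ℤ ℤ.+ y ℤ.* 0ℤ ≡ ℤ.- x
  r₅ = solve-∀

T·≡ : ∀ a b c d → T · ⟦ a , b ⨾ c , d ⟧ ≡ ⟦ a , b ⨾ ℤ.- a ℤ.+ c , ℤ.- b ℤ.+ d ⟧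
T·≡ a b c d = mat-≡ (l₁ a c) (l₁ b d) (l₃ a c) (l₃ b d)

U·≡ : ∀ a b c d → U · ⟦ a , b ⨾ c , d ⟧ ≡ ⟦ a ℤ.+ ℤ.- c , b ℤ.+ ℤ.- d ⨾ c , d ⟧
U·≡ a b c d = mat-≡ (l₄ a c) (l₄ b d) (l₂ a c) (l₂ b d)

S·≡ : ∀ a b c d → S · ⟦ a , b ⨾ c , d ⟧ ≡ ⟦ ℤ.- c , ℤ.- d ⨾ a , b ⟧
S·≡ a b c d = mat-≡ (l₅ a c) (l₅ b d) (l₁ a c) (l₁ b d)

·T≡ : ∀ a b c d → ⟦ a , b ⨾ c , d ⟧ · T ≡ ⟦ a ℤ.+ ℤ.- b , b ⨾ c ℤ.+ ℤ.- d , d ⟧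
·T≡ a b c d = mat-≡ (r₃ a b) (r₂ a b) (r₃ c d) (r₂ c d)

·U≡ : ∀ a b c d → ⟦ a , b ⨾ c , d ⟧ · U ≡ ⟦ a , ℤ.- a ℤ.+ b ⨾ c , ℤ.- c ℤ.+ d ⟧
·U≡ a b c d = mat-≡ (r₁ a b) (r₄ a b) (r₁ c d) (r₄ c d)

·S≡ : ∀ a b c d → ⟦ a , b ⨾ c , d ⟧ · S ≡ ⟦ b , ℤ.- a ⨾ d , ℤ.- c ⟧
·S≡ a b c d = mat-≡ (r₂ a b) (r₅ a b) (r₂ c d) (r₅ c d)

-- Conjugation by diag(1, -1) turns these into the matrices with nonnegative entries and positive
-- diagonal. This sign pattern survives multiplication by `T` and `U` on either side, because every
-- addition is of terms of equal sign.
signed : ℕ → ℕ → ℕ → ℕ → Mat₂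
signed a b c d = ⟦ + suc a , ℤ.- (+ b) ⨾ ℤ.- (+ c) , + suc d ⟧

private
  neg-+ : ∀ a c → (ℤ.- (+ a)) ℤ.+ (ℤ.- (+ c)) ≡ ℤ.- (+ (a ℕ.+ c))
  neg-+ a c = sym (ℤ.neg-distrib-+ (+ a) (+ c))

  neg-suc : ∀ b d → (ℤ.- (+ b)) ℤ.+ (ℤ.- (+ suc d)) ≡ ℤ.- (+ suc (b ℕ.+ d))
  neg-suc b d = trans (neg-+ b (suc d)) (cong (λ k → ℤ.- (+ k)) (ℕ.+-suc b d))

  add-neg : ∀ a c → (+ suc a) ℤ.+ ℤ.- (ℤ.- (+ c)) ≡ + suc (a ℕ.+ c)
  add-neg a c = cong (λ z → (+ suc a) ℤ.+ z) (ℤ.neg-involutive (+ c))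

  neg-add : ∀ b d → ℤ.- (ℤ.- (+ b)) ℤ.+ (+ suc d) ≡ + suc (b ℕ.+ d)
  neg-add b d = trans (cong (λ z → z ℤ.+ (+ suc d)) (ℤ.neg-involutive (+ b))) (cong +_ (ℕ.+-suc b d))

T·signed : ∀ a b c d → T · signed a b c d ≡ signed a b (suc (a ℕ.+ c)) (b ℕ.+ d)
T·signed a b c d = trans (T·≡ (+ suc a) (ℤ.- (+ b)) (ℤ.- (+ c)) (+ suc d))
    (mat-≡ refl refl (neg-+ (suc a) c) (neg-add b d))

U·signed : ∀ a b c d → U · signed a b c d ≡ signed (a ℕ.+ c) (suc (b ℕ.+ d)) c d
U·signed a b c d = trans (U·≡ (+ suc a) (ℤ.- (+ b)) (ℤ.- (+ c)) (+ suc d))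
    (mat-≡ (add-neg a c) (neg-suc b d) refl refl)

signed·T : ∀ a b c d → signed a b c d · T ≡ signed (a ℕ.+ b) b (suc (c ℕ.+ d)) d
signed·T a b c d = trans (·T≡ (+ suc a) (ℤ.- (+ b)) (ℤ.- (+ c)) (+ suc d))
    (mat-≡ (add-neg a b) refl (neg-suc c d) refl)

signed·U : ∀ a b c d → signed a b c d · U ≡ signed a (suc (a ℕ.+ b)) c (c ℕ.+ d)
signed·U a b c d = trans (·U≡ (+ suc a) (ℤ.- (+ b)) (ℤ.- (+ c)) (+ suc d))
    (mat-≡ refl (neg-+ (suc a) b) refl (neg-add c d))

Positive Positive⁺ : Mat₂ → Set
Positive X  = ∃[ a ] ∃[ b ] ∃[ c ] ∃[ d ] X ≈ signed a b c d
Positive⁺ X = ∃[ a ] ∃[ b ] ∃[ c ] ∃[ d ] (b ≢ 0 ⊎ c ≢ 0) × X ≈ signed a b c d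

Positive⁺⇒Positive : ∀ {X} → Positive⁺ X → Positive X
Positive⁺⇒Positive (a , b , c , d , _ , e) = a , b , c , d , e

T·positive : ∀ {X} → Positive X → Positive⁺ (T · X)
T·positive (a , b , c , d , e) = a , b , suc (a ℕ.+ c) , b ℕ.+ d , inj₂ (λ ()) ,
  ≈-trans (·-cong-≈ (≈-refl {T}) e) (inj₁ (T·signed a b c d))

U·positive : ∀ {X} → Positive X → Positive⁺ (U · X)
U·positive (a , b , c , d , e) = a ℕ.+ c , suc (b ℕ.+ d) , c , d , inj₁ (λ ()) ,
  ≈-trans (·-cong-≈ (≈-refl {U}) e) (inj₁ (U·signed a b c d))

positive·T : ∀ {X} → Positive X → Positive⁺ (X · T)
positive·T (a , b , c , d , e) = a ℕ.+ b , b , suc (c ℕ.+ d) , d , inj₂ (λ ()) ,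
  ≈-trans (·-cong-≈ e (≈-refl {T})) (inj₁ (signed·T a b c d))

positive·U : ∀ {X} → Positive X → Positive⁺ (X · U)
positive·U (a , b , c , d , e) = a , suc (a ℕ.+ b) , c , c ℕ.+ d , inj₁ (λ ()) ,
  ≈-trans (·-cong-≈ e (≈-refl {U})) (inj₁ (signed·U a b c d))

Id⊎positive⁺ : ∀ {X} {A : Set} → X ≡ Id × A ⊎ Positive⁺ X → Positive X
Id⊎positive⁺ (inj₁ (refl , _)) = 0 , 0 , 0 , 0 , inj₁ refl
Id⊎positive⁺ (inj₂ p)          = Positive⁺⇒Positive p

positive⁺-≉Id : ∀ {X} → Positive⁺ X → ¬ X ≈ Id
positive⁺-≉Id (a , zero , zero , d , inj₁ ne , e) e′ = ne refl
positive⁺-≉Id (a , zero , zero , d , inj₂ ne , e) e′ = ne refl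
positive⁺-≉Id (a , suc b , c , d , ne , e) e′ with ≈-trans (≈-sym e) e′
... | inj₁ ()
... | inj₂ ()
positive⁺-≉Id (a , zero , suc c , d , ne , e) e′ with ≈-trans (≈-sym e) e′
... | inj₁ ()
... | inj₂ ()

-- `S` exchanges the rows up to sign, which moves the nonzero diagonal entries off the diagonal. On
-- the other side, `S` does the same with the columns.
S·positive-≉Id : ∀ {X} → Positive X → ¬ S · X ≈ Id
S·positive-≉Id (a , b , c , d , e) e′
  with ≈-trans (inj₁ (sym (S·≡ (+ suc a) (ℤ.- (+ b)) (ℤ.- (+ c)) (+ suc d))))
      (≈-trans (·-cong-≈ (≈-refl {S}) (≈-sym e)) e′)
... | inj₁ ()
... | inj₂ ()

positive·S-≉Id : ∀ {X} → Positive X → ¬ X · S ≈ Id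
positive·S-≉Id (a , b , c , d , e) e′
  with ≈-trans (inj₁ (sym (·S≡ (+ suc a) (ℤ.- (+ b)) (ℤ.- (+ c)) (+ suc d))))
      (≈-trans (·-cong-≈ (≈-sym e) (≈-refl {S})) e′)
... | inj₁ eq = absurd (cong Mat₂.e₁₂ eq)
  where
  absurd : ¬ ℤ.- (+ suc a) ≡ 0ℤ
  absurd ()
... | inj₂ eq = absurd (cong Mat₂.e₁₂ eq)
  where
  absurd : ¬ ℤ.- (+ suc a) ≡ 0ℤ
  absurd ()

S·S· : ∀ A → S · (S · A) ≡ -ᴹ A
S·S· A = trans (sym (·-assoc S S A)) (trans (-‿·ˡ Id A) (cong -ᴹ_ (·-identityˡ A)))

·S·S : ∀ A → A · S · S ≡ -ᴹ A
·S·S A = trans (·-assoc A S S) (trans (-‿·ʳ A Id) (cong -ᴹ_ (·-identityʳ A)))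

-- Since S S = -1, multiplying by `S` on both sides would give X = ±1. This excludes further pieces
-- between a complete lowest piece and a complete innermost one.
S·positive⁺·S-≉Id : ∀ {X} → Positive⁺ X → ¬ S · (X · S) ≈ Id
S·positive⁺·S-≉Id {X} p e =
  positive⁺-≉Id p (≈-trans (inj₁ (sym conj)) (≈-trans (·-cong-≈ (·-cong-≈ (≈-refl {S}) e) (≈-refl {S}))
      (inj₂ refl)))
  where
  conj : S · (S · (X · S)) · S ≡ X
  conj = trans (cong (_· S) (S·S· (X · S)))
        (trans (-‿·ˡ (X · S) S) (trans (cong -ᴹ_ (·S·S X)) (-ᴹ-involutive X)))

-- Reducing a word with a stack of unfinished pieces

Forest : Set
Forest = List Tree

AllTernary : Forest → Set
AllTernary = All (Every Ternary)

-- A stack of unfinished pieces, the innermost first.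
stackWord : List Forest → Word
stackWord []       = []
stackWord (f ∷ fs) = stackWord fs ++ word* f

-- The pieces below the innermost one. Only the lowest may be complete, having nothing beneath it to
-- become a subtree of; it ends up as the first of the two polygons.
data Pending : List Forest → Set where
  []     : Pending []
  bottom : ∀ {f} → AllTernary f → Pending (f ∷ [])
  push   : ∀ {f g fs} → AllTernary f → Incomplete (length f) → Pending (g ∷ fs) → Pending (f ∷ g ∷ fs)

pop : ∀ {f fs} → Pending (f ∷ fs) → AllTernary f × Pending fs
pop (bottom a)   = a , []
pop (push a _ p) = a , p

-- This is where positivity of the entries enters: every `step` is followed by a `tick`, so the two
-- are fused into `next`, and the part already read always ends in a `tick`, as every `stackWord` of
-- a nonempty stack does.
data Move : Set where
  again next : Move

unfold : List Move → Word
unfold []          = []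
unfold (again ∷ m) = tick ∷ unfold m
unfold (next ∷ m)  = step ∷ tick ∷ unfold m

word*-∷ʳ : ∀ ts t → word* (ts ∷ʳ t) ≡ word* ts ++ word t ++ tick ∷ []
word*-∷ʳ []       t = refl
word*-∷ʳ (u ∷ ts) t = cong (tick ∷_) (trans (cong (word u ++_) (word*-∷ʳ ts t))
    (sym (++-assoc (word u) (word* ts) _)))

stackWord-∷ʳ : ∀ f t fs → stackWord (f ∷ʳ t ∷ fs) ≡ stackWord (f ∷ fs) ++ word t ++ tick ∷ []
stackWord-∷ʳ f t fs = trans (cong (stackWord fs ++_) (word*-∷ʳ f t)) (sym (++-assoc (stackWord fs) (word* f) _))

-- A further tick at the same vertex closes the innermost piece if that is a
-- 3d-gon with a piece below it, whose subtree it becomes; otherwise it opens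
-- a new piece.
parse : ∀ f fs → AllTernary f → Pending fs → ∀ m → ∃[ g ] ∃[ gs ]
  AllTernary g × Pending gs × stackWord (f ∷ fs) ++ unfold m ≡ stackWord (g ∷ gs)
parse f fs a p [] = f , fs , a , p , ++-identityʳ _
parse f fs a p (next ∷ m) with parse (f ∷ʳ leaf) fs (∷ʳ⁺ a leaf) p m
... | g , gs , a′ , p′ , eq = g , gs , a′ , p′ ,
      trans (sym (++-assoc (stackWord (f ∷ fs)) (step ∷ tick ∷ []) (unfold m)))
        (trans (cong (_++ unfold m) (sym (stackWord-∷ʳ f leaf fs))) eq)
parse f fs a p (again ∷ m) with G-cases (length f)
parse f fs a p (again ∷ m) | inj₂ inc with parse [] (f ∷ fs) [] (pend fs p) m
  where
  pend : ∀ fs → Pending fs → Pending (f ∷ fs)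
  pend []       p = bottom a
  pend (_ ∷ _)  p = push a inc p
... | g , gs , a′ , p′ , eq = g , gs , a′ , p′ ,
      trans (sym (++-assoc (stackWord (f ∷ fs)) (tick ∷ []) (unfold m))) eq
parse f [] a p (again ∷ m) | inj₁ com with parse [] (f ∷ []) [] (bottom a) m
... | g , gs , a′ , p′ , eq = g , gs , a′ , p′ ,
      trans (sym (++-assoc (word* f) (tick ∷ []) (unfold m))) eq
-- The `tick` just read is the corner of `h` at the far end of its new subtree.
parse f (h ∷ fs) a p (again ∷ m) | inj₁ (d , _) with pop p
... | b , q with parse (h ∷ʳ node f) fs (∷ʳ⁺ b (node d a)) q m
... | g , gs , a′ , p′ , eq = g , gs , a′ , p′ ,
      trans (sym (++-assoc (stackWord (h ∷ fs) ++ word* f) (tick ∷ []) (unfold m)))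
        (trans (cong (_++ unfold m)
          (trans (++-assoc (stackWord (h ∷ fs)) (word* f) (tick ∷ []))
            (sym (stackWord-∷ʳ h (node f) fs)))) eq)

φ-stack-∷ : ∀ f fs → φ (stackWord (f ∷ fs)) ≡ φ (word* f) · φ (stackWord fs)
φ-stack-∷ f fs = φ-++ (stackWord fs) (word* f)

φ-incomplete· : ∀ {f X} → AllTernary f → Incomplete (length f) → Positive X → Positive⁺ (φ (word* f) · X)
φ-incomplete· {f} {X} a (_ , e) p = Sum.[ (λ e → shift e (T·positive p)) , (λ e → shift e (U·positive p)) ] e
  where
  shift : ∀ {Z} → G (length f) ≈ Z → Positive⁺ (Z · X) → Positive⁺ (φ (word* f) · X)
  shift e (a′ , b , c , d , n , e′) =
    a′ , b , c , d , n , ≈-trans (·-cong-≈ (≈-trans (φ-tree* a) e) (≈-refl {X})) e′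

-- The lowest piece `f₀` is split off because it alone may be complete; all others are incomplete,
-- and their product `X` stays in the monoid of `T` and `U`.
φ-pending : ∀ {f fs} → Pending (f ∷ fs) → ∃[ X ] ∃[ f₀ ]
  φ (stackWord (f ∷ fs)) ≈ X · G (length f₀) × (X ≡ Id × f₀ ≡ f × fs ≡ [] ⊎ Positive⁺ X)
φ-pending {f} (bottom a) = Id , f , ≈-trans (φ-tree* a) (inj₁ (sym (·-identityˡ _))) , inj₁ (refl , refl , refl)
φ-pending {f} {fs} (push a inc p) with φ-pending p
... | X , f₀ , e , c = φ (word* f) · X , f₀ ,
      ≈-trans (inj₁ (φ-stack-∷ f fs))
        (≈-trans (·-cong-≈ (≈-refl {φ (word* f)}) e) (inj₁ (sym (·-assoc (φ (word* f)) X _)))) ,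
      inj₂ (φ-incomplete· a inc (Id⊎positive⁺ c))

G-incomplete-≉Id : ∀ {k} → Incomplete k → ¬ G k ≈ Id
G-incomplete-≉Id (_ , inj₁ e) e′ with ≈-trans (≈-sym e) e′
... | inj₁ ()
... | inj₂ ()
G-incomplete-≉Id (_ , inj₂ e) e′ with ≈-trans (≈-sym e) e′
... | inj₁ ()
... | inj₂ ()

S≉Id : ¬ S ≈ Id
S≉Id (inj₁ ())
S≉Id (inj₂ ())

·incomplete : ∀ {X k} → Incomplete k → Positive X → Positive⁺ (X · G k)
·incomplete {X} (_ , inj₁ e) p with positive·T p
... | a , b , c , d , n , e′ = a , b , c , d , n , ≈-trans (·-cong-≈ (≈-refl {X}) e) e′
·incomplete {X} (_ , inj₂ e) p with positive·U p
... | a , b , c , d , n , e′ = a , b , c , d , n , ≈-trans (·-cong-≈ (≈-refl {X}) e) e′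

-- A single piece gives `S`, `T` or `U`, none of them ±1. For two or more, completeness of the
-- innermost and of the lowest piece gives the shapes S X S, S Y, Y S and Y with Y a nonempty
-- product of `T` and `U`; only the first can be ±1, and only for empty X.
stack-≈Id : ∀ f fs → AllTernary f → Pending fs → φ (stackWord (f ∷ fs)) ≈ Id →
  ∃[ g ] (fs ≡ g ∷ [] × Every Ternary (node f) × Every Ternary (node g))
stack-≈Id f [] a p e with G-cases (length f) | ≈-trans (≈-sym (φ-tree* a)) e
... | inj₁ (_ , e₁) | e₂ = ⊥-elim (S≉Id (≈-trans (≈-sym e₁) e₂))
... | inj₂ inc      | e₂ = ⊥-elim (G-incomplete-≉Id inc e₂)
stack-≈Id f (g ∷ fs) a p e with φ-pending p
... | X , f₀ , eX , c with G-cases (length f) | G-cases (length f₀)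
...   | inj₁ (df , ef) | inj₁ (dg , eg) = lemma c
  where
  total : S · (X · S) ≈ Id
  total = ≈-trans (·-cong-≈ (≈-sym (≈-trans (φ-tree* a) ef)) (≈-sym (≈-trans eX (·-cong-≈ (≈-refl {X}) eg))))
            (≈-trans (inj₁ (sym (φ-stack-∷ f (g ∷ fs)))) e)
  lemma : X ≡ Id × f₀ ≡ g × fs ≡ [] ⊎ Positive⁺ X →
    ∃[ h ] (g ∷ fs ≡ h ∷ [] × Every Ternary (node f) × Every Ternary (node h))
  lemma (inj₁ (_ , refl , refl)) = g , refl , node df a , node dg (proj₁ (pop p))
  lemma (inj₂ pos)               = ⊥-elim (S·positive⁺·S-≉Id pos total)
...   | inj₁ (df , ef) | inj₂ inc =
        ⊥-elim (S·positive-≉Id (Positive⁺⇒Positive (·incomplete inc (Id⊎positive⁺ c)))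
          (≈-trans (·-cong-≈ (≈-sym (≈-trans (φ-tree* a) ef)) (≈-sym eX))
              (≈-trans (inj₁ (sym (φ-stack-∷ f (g ∷ fs)))) e)))
...   | inj₂ inc | inj₁ (dg , eg) =
        ⊥-elim (positive·S-≉Id (Positive⁺⇒Positive (φ-incomplete· a inc (Id⊎positive⁺ c)))
          (≈-trans (inj₁ (·-assoc (φ (word* f)) X S))
            (≈-trans (·-cong-≈ (≈-refl {φ (word* f)}) (≈-sym (≈-trans eX (·-cong-≈ (≈-refl {X}) eg))))
              (≈-trans (inj₁ (sym (φ-stack-∷ f (g ∷ fs)))) e))))
...   | inj₂ inc | inj₂ inc₀ =
        ⊥-elim (positive⁺-≉Id (·incomplete inc₀ (Positive⁺⇒Positive (φ-incomplete· a inc (Id⊎positive⁺ c))))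
          (≈-trans (inj₁ (·-assoc (φ (word* f)) X _))
            (≈-trans (·-cong-≈ (≈-refl {φ (word* f)}) (≈-sym eX))
              (≈-trans (inj₁ (sym (φ-stack-∷ f (g ∷ fs)))) e))))

-- The pieces of a dissection described by a tree

mark : ∀ {N} → ℕ → Subset N → Subset N
mark _       []      = []
mark zero    (_ ∷ V) = true ∷ V
mark (suc k) (b ∷ V) = b ∷ mark k V

support : ∀ N → List ℕ → Subset N
support N []       = ⊥
support N (v ∷ vs) = mark v (support N vs)

∈-mark⁻ : ∀ {N} k {V : Subset N} {i} → i ∈ˢ mark k V → toℕ i ≡ k ⊎ i ∈ˢ V
∈-mark⁻ zero    {_ ∷ V} here       = inj₁ refl
∈-mark⁻ zero    {_ ∷ V} (there i∈) = inj₂ (there i∈)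
∈-mark⁻ (suc k) {_ ∷ V} here       = inj₂ here
∈-mark⁻ (suc k) {_ ∷ V} (there i∈) = Sum.map (cong suc) there (∈-mark⁻ k i∈)

∈-mark⁺ : ∀ {N} k {V : Subset N} {i} → toℕ i ≡ k ⊎ i ∈ˢ V → i ∈ˢ mark k V
∈-mark⁺ zero    {_ ∷ V} {zero}  _               = here
∈-mark⁺ zero    {_ ∷ V} {suc i} (inj₂ (there p)) = there p
∈-mark⁺ (suc k) {_ ∷ V} {zero}  (inj₂ here)     = here
∈-mark⁺ (suc k) {_ ∷ V} {suc i} (inj₁ p)        = there (∈-mark⁺ k (inj₁ (ℕ.suc-injective p)))
∈-mark⁺ (suc k) {_ ∷ V} {suc i} (inj₂ (there p)) = there (∈-mark⁺ k (inj₂ p))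

∈-support⁻ : ∀ {N} vs {i : Fin N} → i ∈ˢ support N vs → toℕ i ∈ vs
∈-support⁻ []       i∈ = ⊥-elim (∉⊥ i∈)
∈-support⁻ (v ∷ vs) i∈ = Sum.[ here , (λ p → there (∈-support⁻ vs p)) ] (∈-mark⁻ v i∈)

∈-support⁺ : ∀ {N} vs {i : Fin N} → toℕ i ∈ vs → i ∈ˢ support N vs
∈-support⁺ (v ∷ vs) (here eq)  = ∈-mark⁺ v (inj₁ eq)
∈-support⁺ (v ∷ vs) (there i∈) = ∈-mark⁺ v (inj₂ (∈-support⁺ vs i∈))

∣mark∣≤ : ∀ {N} k (V : Subset N) → ∣ mark k V ∣ ≤ suc ∣ V ∣
∣mark∣≤ _       []          = z≤n
∣mark∣≤ zero    (true ∷ V)  = s≤s (ℕ.n≤1+n _)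
∣mark∣≤ zero    (false ∷ V) = ℕ.≤-refl
∣mark∣≤ (suc k) (true ∷ V)  = s≤s (∣mark∣≤ k V)
∣mark∣≤ (suc k) (false ∷ V) = ∣mark∣≤ k V

∣mark∣ : ∀ {N} k (V : Subset N) → k ℕ.< N → (∀ i → toℕ i ≡ k → i ∉ˢ V) → ∣ mark k V ∣ ≡ suc ∣ V ∣
∣mark∣ zero    (true ∷ V)  k<         fresh = ⊥-elim (fresh zero refl here)
∣mark∣ zero    (false ∷ V) k<         fresh = refl
∣mark∣ (suc k) (true ∷ V)  (s≤s k<) fresh = cong suc (∣mark∣ k V k< (λ i eq i∈ →
    fresh (suc i) (cong suc eq) (there i∈)))
∣mark∣ (suc k) (false ∷ V) (s≤s k<) fresh = ∣mark∣ k V k< (λ i eq i∈ → fresh (suc i) (cong suc eq) (there i∈))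

∣support∣≤ : ∀ {N} vs → ∣ support N vs ∣ ≤ length vs
∣support∣≤ {N} []       = ℕ.≤-reflexive (∣⊥∣≡0 N)
∣support∣≤ {N} (v ∷ vs) = ℕ.≤-trans (∣mark∣≤ v (support N vs)) (s≤s (∣support∣≤ vs))

∣corners∣ : ∀ {N} x ts → All Branching ts → end* x ts ℕ.< N → ∣ support N (corners x ts) ∣ ≡ suc (length ts)
∣corners∣ {N} x []       []       e< = trans (∣mark∣ x ⊥ e< (λ _ _ → ∉⊥)) (cong suc (∣⊥∣≡0 N))
∣corners∣ {N} x (t ∷ ts) (p ∷ ps) e< = trans
  (∣mark∣ x (support N (corners (end x t) ts)) (ℕ.≤-<-trans (≤-end* x (p ∷ ps)) e<)
    (λ i eq i∈ → ℕ.<⇒≱ (<-end x p) (ℕ.≤-trans (proj₁ (corners-bounds (end x t) ps (∈-support⁻ _ i∈)))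
        (ℕ.≤-reflexive eq))))
  (cong suc (∣corners∣ (end x t) ts ps e<))

-- Extremal vertices and gaps of a vertex set

module _ {P : ℕ → Set} (P? : ∀ z → Dec (P z)) where

  greatest : ∀ {a} b → a ≤ b → P a → ∃[ m ] (a ≤ m × m ≤ b × P m × (∀ z → z ≤ b → P z → z ≤ m))
  greatest {a} b a≤b Pa with P? b
  ... | yes Pb = b , a≤b , ℕ.≤-refl , Pb , λ z z≤b _ → z≤b
  greatest {a} b a≤b Pa | no ¬Pb with ℕ.m≤n⇒m<n∨m≡n a≤b
  ... | inj₂ refl = ⊥-elim (¬Pb Pa)
  greatest {a} (suc b) a≤b Pa | no ¬Pb | inj₁ (s≤s a≤b′) with greatest b a≤b′ Pa
  ... | m , a≤m , m≤b , Pm , max = m , a≤m , ℕ.m≤n⇒m≤1+n m≤b , Pm , max′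
    where
    max′ : ∀ z → z ≤ suc b → P z → z ≤ m
    max′ z z≤ Pz with ℕ.m≤n⇒m<n∨m≡n z≤
    ... | inj₁ (s≤s z≤b) = max z z≤b Pz
    ... | inj₂ refl      = ⊥-elim (¬Pb Pz)

  least : ∀ k b → P (k ℕ.+ b) → ∃[ m ] (b ≤ m × m ≤ k ℕ.+ b × P m × (∀ z → b ≤ z → P z → m ≤ z))
  least zero b Pb = b , ℕ.≤-refl , ℕ.≤-refl , Pb , λ z b≤z _ → b≤z
  least (suc k) b Pe with P? b
  ... | yes Pb = b , ℕ.≤-refl , ℕ.m≤n+m b (suc k) , Pb , λ z b≤z _ → b≤z
  ... | no ¬Pb with least k (suc b) (subst P (sym (ℕ.+-suc k b)) Pe)
  ... | m , b<m , m≤e , Pm , min = m , ℕ.<⇒≤ b<m , ℕ.≤-trans m≤e (ℕ.≤-reflexive (ℕ.+-suc k b)) , Pm , min′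
    where
    min′ : ∀ z → b ≤ z → P z → m ≤ z
    min′ z b≤z Pz with ℕ.m≤n⇒m<n∨m≡n b≤z
    ... | inj₁ b<z  = min z b<z Pz
    ... | inj₂ refl = ⊥-elim (¬Pb Pz)

module _ {N : ℕ} (V : Subset N) where

  Has : ℕ → Set
  Has z = ∃[ i ] (toℕ i ≡ z × i ∈ˢ V)

  has? : ∀ z → Dec (Has z)
  has? z = any? (λ i → (toℕ i ℕ.≟ z) ×-dec (i ∈? V))

  greatest-below : ∀ {i} b → i ∈ˢ V → toℕ i ≤ b →
    ∃[ m ] (m ∈ˢ V × toℕ i ≤ toℕ m × toℕ m ≤ b × (∀ z → z ∈ˢ V → toℕ z ≤ b → toℕ z ≤ toℕ m))
  greatest-below {i} b i∈ i≤b with greatest has? b i≤b (i , refl , i∈)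
  ... | _ , i≤m , m≤b , (m , refl , m∈) , max = m , m∈ , i≤m , m≤b , λ z z∈ z≤b → max (toℕ z) z≤b (z , refl , z∈)

  least-above : ∀ {i} b → i ∈ˢ V → b ≤ toℕ i →
    ∃[ m ] (m ∈ˢ V × b ≤ toℕ m × toℕ m ≤ toℕ i × (∀ z → z ∈ˢ V → b ≤ toℕ z → toℕ m ≤ toℕ z))
  least-above {i} b i∈ b≤i with least has? (toℕ i ℕ.∸ b) b (i , sym (ℕ.m∸n+n≡m b≤i) , i∈)
  ... | _ , b≤m , m≤i , (m , refl , m∈) , min =
        m , m∈ , b≤m , ℕ.≤-trans m≤i (ℕ.≤-reflexive (ℕ.m∸n+n≡m b≤i)) , λ z z∈ b≤z → min (toℕ z) b≤z (z , refl , z∈)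

  -- The vertices of `V` nearest to the missing point `z` on its two sides have nothing of `V`
  -- between them, hence span a side of `V`.
  gap : ∀ {x y} z → x ∈ˢ V → y ∈ˢ V → toℕ x ℕ.< z → z ℕ.< toℕ y → (∀ i → toℕ i ≡ z → i ∉ˢ V) →
    ∃[ u ] ∃[ w ] (u ∈ˢ V × w ∈ˢ V × toℕ u ℕ.< z × z ℕ.< toℕ w × IsSide V u w ×
        (∀ i → i ∈ˢ V → toℕ i ≤ toℕ u ⊎ toℕ w ≤ toℕ i))
  gap z x∈ y∈ x<z z<y z∉ with greatest-below z x∈ (ℕ.<⇒≤ x<z) | least-above z y∈ (ℕ.<⇒≤ z<y)
  ... | u , u∈ , _ , u≤z , max | w , w∈ , z≤w , _ , min =
        u , w , u∈ , w∈ , u<z , z<w , (ℕ.<-trans u<z z<w , u∈ , w∈ , inj₁ consecutive) , consecutive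
    where
    u<z : toℕ u ℕ.< z
    u<z = ℕ.≤∧≢⇒< u≤z (λ eq → z∉ u eq u∈)
    z<w : z ℕ.< toℕ w
    z<w = ℕ.≤∧≢⇒< z≤w (λ eq → z∉ w (sym eq) w∈)
    consecutive : ∀ i → i ∈ˢ V → toℕ i ≤ toℕ u ⊎ toℕ w ≤ toℕ i
    consecutive i i∈ with ℕ.≤-total (toℕ i) z
    ... | inj₁ i≤z = inj₁ (max i i∈ i≤z)
    ... | inj₂ z≤i = inj₂ (min i i∈ z≤i)

  third-element : 3 ≤ ∣ V ∣ → ∀ x y → ∃[ i ] (i ∈ˢ V × toℕ i ≢ x × toℕ i ≢ y)
  third-element 3≤ x y with any? (λ i → (i ∈? V) ×-dec (¬? (toℕ i ℕ.≟ x) ×-dec ¬? (toℕ i ℕ.≟ y)))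
  ... | yes found = found
  ... | no ¬found = ⊥-elim (ℕ.<⇒≱ 3≤ (ℕ.≤-trans (p⊆q⇒∣p∣≤∣q∣ V⊆) (∣support∣≤ {N} (x ∷ y ∷ []))))
    where
    V⊆ : ∀ {i} → i ∈ˢ V → i ∈ˢ support N (x ∷ y ∷ [])
    V⊆ {i} i∈ with toℕ i ℕ.≟ x | toℕ i ℕ.≟ y
    ... | yes i≡x | _       = ∈-support⁺ (x ∷ y ∷ []) (here i≡x)
    ... | no  _   | yes i≡y = ∈-support⁺ (x ∷ y ∷ []) (there (here i≡y))
    ... | no  i≢x | no i≢y  = ⊥-elim (¬found (i , i∈ , i≢x , i≢y))

⊤-side⁻ : ∀ {n} {x y : Fin (suc n)} → IsSide ⊤ x y → toℕ y ≡ suc (toℕ x) ⊎ (toℕ x ≡ 0 × toℕ y ≡ n)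
⊤-side⁻ {n} {x} {y} (x<y , _ , _ , inj₁ gap) = inj₁ (ℕ.≤-antisym y≤ x<y)
  where
  1+x<N : suc (toℕ x) ℕ.< suc n
  1+x<N = ℕ.<-≤-trans (s≤s x<y) (toℕ<n y)
  sx : Fin (suc n)
  sx = fromℕ< 1+x<N
  y≤ : toℕ y ≤ suc (toℕ x)
  y≤ with gap sx ∈⊤
  ... | inj₁ sx≤x = ⊥-elim (ℕ.<⇒≱ ℕ.≤-refl (subst (_≤ toℕ x) (toℕ-fromℕ< 1+x<N) sx≤x))
  ... | inj₂ y≤sx = subst (toℕ y ≤_) (toℕ-fromℕ< 1+x<N) y≤sx
⊤-side⁻ {n} {x} {y} (x<y , _ , _ , inj₂ wrap) = inj₂
  ( ℕ.n≤0⇒n≡0 (proj₁ (wrap zero ∈⊤))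
  , ℕ.≤-antisym (ℕ.≤-pred (toℕ<n y)) (subst (_≤ toℕ y) (toℕ-fromℕ< (ℕ.≤-refl {suc n}))
      (proj₂ (wrap (fromℕ< ℕ.≤-refl) ∈⊤))))

⊤-side-suc : ∀ {N} {x y : Fin N} → toℕ y ≡ suc (toℕ x) → IsSide ⊤ x y
⊤-side-suc {x = x} {y} eq = ℕ.≤-reflexive (sym eq) , ∈⊤ , ∈⊤ , inj₁ split
  where
  split : ∀ z → z ∈ˢ ⊤ → toℕ z ≤ toℕ x ⊎ toℕ y ≤ toℕ z
  split z _ with toℕ z ℕ.≤? toℕ x
  ... | yes z≤x = inj₁ z≤x
  ... | no z≰x  = inj₂ (subst (_≤ toℕ z) (sym eq) (ℕ.≰⇒> z≰x))

⊤-side-wrap : ∀ {n} {x y : Fin (suc n)} → 0 ℕ.< n → toℕ x ≡ 0 → toℕ y ≡ n → IsSide ⊤ x y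
⊤-side-wrap 0<n x≡0 y≡n = subst₂ ℕ._<_ (sym x≡0) (sym y≡n) 0<n , ∈⊤ , ∈⊤ ,
  inj₂ (λ z _ → subst (_≤ toℕ z) (sym x≡0) z≤n , subst (toℕ z ≤_) (sym y≡n) (ℕ.≤-pred (toℕ<n z)))

pieces-trans : ∀ x {t o o′} → o ∈ pieces x t → o′ ∈ pieces* (left o) (proj₂ o) → o′ ∈ pieces x t
pieces*-trans : ∀ x {ts o o′} → o ∈ pieces* x ts → o′ ∈ pieces* (left o) (proj₂ o) → o′ ∈ pieces* x ts
pieces-trans x {node ts} (here refl) o′∈ = there o′∈
pieces-trans x {node ts} (there o∈)  o′∈ = there (pieces*-trans x {ts} o∈ o′∈)
pieces*-trans x {t ∷ ts} o∈ o′∈ with ∈-++⁻ (pieces x t) o∈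
... | inj₁ o∈t  = ∈-++⁺ˡ (pieces-trans x {t} o∈t o′∈)
... | inj₂ o∈ts = ∈-++⁺ʳ (pieces x t) (pieces*-trans (end x t) {ts} o∈ts o′∈)

-- The sub-polygons are exactly the pieces of the tree

vertices : ∀ N → Piece → Subset N
vertices N (x , ts) = support N (corners x ts)

-- The base of the root is the side [0, n], so only the pieces of `pieces* 0 rs` are matched with
-- diagonals.
record Describes {n} (rs : List Tree) (D : Dissection (suc n)) : Set where
  field
    branching  : Branching (node rs)
    end≡n      : end* 0 rs ≡ n
    ∈-diagonals⁻ : ∀ {i j} → (i , j) ∈ diagonals D → ∃[ o ] (o ∈ pieces* 0 rs × left o ≡ toℕ i × right o ≡ toℕ j)
    ∈-diagonals⁺ : ∀ {o} → o ∈ pieces* 0 rs → ∃[ i ] ∃[ j ] (toℕ i ≡ left o × toℕ j ≡ right o ×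
        (i , j) ∈ diagonals D)

module _ {n} {rs : List Tree} {D : Dissection (suc n)} (des : Describes rs D) where
  open Describes des

  private
    N : ℕ
    N = suc n

    t : Tree
    t = node rs

    branching* : ∀ {o} → o ∈ pieces 0 t → All Branching (proj₂ o) × 2 ≤ length (proj₂ o)
    branching* o∈ = subtrees-Every 0 branching o∈ , pieces-Every 0 branching o∈

    right<N : ∀ {o} → o ∈ pieces 0 t → right o ℕ.< N
    right<N o∈ = s≤s (ℕ.≤-trans (proj₂ (proj₂ (pieces-bounds 0 branching o∈))) (ℕ.≤-reflexive end≡n))

    0<n : 0 ℕ.< n
    0<n = subst (0 ℕ.<_) end≡n (<-end 0 branching)

  base-edge : ∀ {o} → o ∈ pieces 0 t →
    ∃[ i ] ∃[ j ] (toℕ i ≡ left o × toℕ j ≡ right o × (IsSide ⊤ i j ⊎ (i , j) ∈ diagonals D))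
  base-edge (here refl) = zero , fromℕ< ℕ.≤-refl , refl , trans (toℕ-fromℕ< ℕ.≤-refl) (sym end≡n) ,
    inj₁ (⊤-side-wrap 0<n refl (toℕ-fromℕ< ℕ.≤-refl))
  base-edge (there o∈) with ∈-diagonals⁺ o∈
  ... | i , j , i≡ , j≡ , ij∈ = i , j , i≡ , j≡ , inj₂ ij∈

  base-edge′ : ∀ {o} → o ∈ pieces 0 t → ∀ {i j} → toℕ i ≡ left o → toℕ j ≡ right o →
    IsSide ⊤ i j ⊎ (i , j) ∈ diagonals D
  base-edge′ o∈ {i} {j} i≡ j≡ with base-edge o∈
  ... | i′ , j′ , i′≡ , j′≡ , e with toℕ-injective {i = i} {i′} (trans i≡ (sym i′≡)) | toℕ-injective {i =
      j} {j′} (trans j≡ (sym j′≡))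
  ... | refl | refl = e

  edge⁻ : ∀ {i j} → IsSide ⊤ i j ⊎ (i , j) ∈ diagonals D →
    toℕ j ≡ suc (toℕ i) ⊎ ∃[ o ] (o ∈ pieces 0 t × left o ≡ toℕ i × right o ≡ toℕ j)
  edge⁻ (inj₁ s) with ⊤-side⁻ s
  ... | inj₁ eq = inj₁ eq
  ... | inj₂ (i≡0 , j≡n) = inj₂ ((0 , rs) , here refl , sym i≡0 , trans end≡n (sym j≡n))
  edge⁻ (inj₂ ij∈) with ∈-diagonals⁻ ij∈
  ... | o , o∈ , eqs = inj₂ (o , there o∈ , eqs)

  -- A diagonal with both ends among the corners of `o` is the base of a piece nested in `o`. If
  -- that piece is not `o` itself, no corner lies strictly under it, so its ends are consecutive
  -- corners.
  piece⇒subpolygon : ∀ {o} → o ∈ pieces 0 t → IsSubpolygon D (vertices N o)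
  piece⇒subpolygon {o@(x , us)} o∈ = size , sides , inner
    where
    bs   = proj₁ (branching* o∈)
    2≤us = proj₂ (branching* o∈)
    V    = vertices N o
    size : 3 ≤ ∣ V ∣
    size = subst (3 ≤_) (sym (∣corners∣ x us bs (right<N o∈))) (s≤s 2≤us)
    bounds : ∀ {i} → i ∈ˢ V → x ≤ toℕ i × toℕ i ≤ end* x us
    bounds i∈ = corners-bounds x bs (∈-support⁻ _ i∈)
    at : ∀ {z} → z ∈ corners x us → ∃[ i ] (toℕ i ≡ z × i ∈ˢ V)
    at {z} z∈ = fromℕ< z<N , toℕ-fromℕ< z<N , ∈-support⁺ _ (subst (_∈ corners x us) (sym (toℕ-fromℕ< z<N)) z∈)
      where
      z<N : z ℕ.< N
      z<N = ℕ.≤-<-trans (proj₂ (corners-bounds x bs z∈)) (right<N o∈)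
    sides : ∀ u w → IsSide V u w → IsSide ⊤ u w ⊎ (u , w) ∈ diagonals D
    sides u w (u<w , u∈ , w∈ , inj₁ split)
      with corners-consecutive x bs (∈-support⁻ _ u∈) (∈-support⁻ _ w∈) u<w split′
      where
      split′ : ∀ z → z ∈ corners x us → z ≤ toℕ u ⊎ toℕ w ≤ z
      split′ z z∈ with at z∈
      ... | i , refl , i∈ = split i i∈
    ... | inj₁ eq = inj₁ (⊤-side-suc eq)
    ... | inj₂ (o′ , o′∈ , l≡ , r≡) = base-edge′ (pieces-trans 0 {t} o∈ o′∈) (sym l≡) (sym r≡)
    sides u w (u<w , u∈ , w∈ , inj₂ wrap) = base-edge′ o∈
      (ℕ.≤-antisym u≤x (proj₁ (bounds u∈))) (ℕ.≤-antisym (proj₂ (bounds w∈)) y≤w)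
      where
      u≤x : toℕ u ≤ x
      u≤x with at (left∈corners x us)
      ... | i , eq , i∈ = subst (toℕ u ≤_) eq (proj₁ (wrap i i∈))
      y≤w : end* x us ≤ toℕ w
      y≤w with at (right∈corners x us)
      ... | i , eq , i∈ = subst (_≤ toℕ w) eq (proj₂ (wrap i i∈))
    inner : ∀ i j → (i , j) ∈ diagonals D → i ∈ˢ V → j ∈ˢ V → IsSide V i j
    inner i j ij∈ i∈ j∈ with ∈-diagonals⁻ ij∈
    ... | o′ , o′∈ , l≡ , r≡
        with pieces-nested 0 branching o∈ (there o′∈)
               (subst (x ≤_) (sym l≡) (proj₁ (bounds i∈))) (subst (_≤ end* x us) (sym r≡) (proj₂ (bounds j∈)))
    ...   | inj₁ refl = i<j , i∈ , j∈ , inj₂ (λ z z∈ →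
              subst (_≤ toℕ z) l≡ (proj₁ (bounds z∈)) , subst (toℕ z ≤_) r≡ (proj₂ (bounds z∈)))
      where
      i<j : toℕ i ℕ.< toℕ j
      i<j = subst₂ ℕ._<_ l≡ r≡ (ℕ.<⇒≤ (proj₁ (proj₂ (pieces-bounds 0 branching o∈))))
    ...   | inj₂ o′∈us = i<j , i∈ , j∈ , inj₁ (λ z z∈ →
              Sum.map (subst (toℕ z ≤_) l≡) (subst (_≤ toℕ z) r≡) (corners-uncovered x bs o′∈us (∈-support⁻ _ z∈)))
      where
      i<j : toℕ i ℕ.< toℕ j
      i<j = subst₂ ℕ._<_ l≡ r≡ (ℕ.<⇒≤ (proj₁ (proj₂ (pieces*-bounds x bs o′∈us))))

  -- The least and greatest vertices x and y of `V` span a side of `V`. A third vertex lies between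
  -- them, so [x, y] is the base of a piece. Each vertex by which `V` and the corners of that piece
  -- differed would yield a forbidden position of a diagonal.
  subpolygon⇒piece : ∀ {V} → IsSubpolygon D V → ∃[ o ] (o ∈ pieces 0 t × V ≡ vertices N o)
  -- No vertex has number N, so this only asks for some element of `V`.
  subpolygon⇒piece {V} (3≤ , sides , inner) with third-element V 3≤ N N
  ... | a , a∈ , _ with greatest-below V n a∈ (ℕ.≤-pred (toℕ<n a)) | least-above V 0 a∈ z≤n
  ... | y , y∈ , _ , _ , max | x , x∈ , _ , _ , min with third-element V 3≤ (toℕ x) (toℕ y)
  ... | m , m∈ , m≢x , m≢y = find (edge⁻ (sides x y (x<y , x∈ , y∈ , inj₂ inside)))
    where
    inside : ∀ z → z ∈ˢ V → toℕ x ≤ toℕ z × toℕ z ≤ toℕ y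
    inside z z∈ = min z z∈ z≤n , max z z∈ (ℕ.≤-pred (toℕ<n z))
    x<m : toℕ x ℕ.< toℕ m
    x<m = ℕ.≤∧≢⇒< (proj₁ (inside m m∈)) (λ eq → m≢x (sym eq))
    m<y : toℕ m ℕ.< toℕ y
    m<y = ℕ.≤∧≢⇒< (proj₂ (inside m m∈)) m≢y
    x<y : toℕ x ℕ.< toℕ y
    x<y = ℕ.<-trans x<m m<y

    -- The piece lying under the side of V that spans a missing point z.
    over : ∀ z → toℕ x ℕ.< z → z ℕ.< toℕ y → (∀ i → toℕ i ≡ z → i ∉ˢ V) → ∃[ o ] (o ∈ pieces 0 t ×
      Has V (left o) × Has V (right o) × left o ℕ.< z × z ℕ.< right o ×
          (∀ i → i ∈ˢ V → toℕ i ≤ left o ⊎ right o ≤ toℕ i))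
    over z x<z z<y z∉ with gap V z x∈ y∈ x<z z<y z∉
    ... | u , w , u∈ , w∈ , u<z , z<w , side , split with edge⁻ (sides u w side)
    ...   | inj₁ w≡1+u = ⊥-elim (ℕ.<⇒≱ u<z (ℕ.≤-pred (subst (z ℕ.<_) w≡1+u z<w)))
    ...   | inj₂ ((.(toℕ u) , us) , o∈ , refl , r≡) = (toℕ u , us) , o∈ , (u , refl , u∈) ,
        (w , sym r≡ , w∈) , u<z ,
              subst (z ℕ.<_) (sym r≡) z<w , λ i i∈ → Sum.map₂ (subst (_≤ toℕ i) (sym r≡)) (split i i∈)

    find : toℕ y ≡ suc (toℕ x) ⊎ ∃[ o ] (o ∈ pieces 0 t × left o ≡ toℕ x × right o ≡ toℕ y) →
           ∃[ o ] (o ∈ pieces 0 t × V ≡ vertices N o)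
    find (inj₁ y≡1+x) = ⊥-elim (ℕ.<⇒≱ x<m (ℕ.≤-pred (subst (toℕ m ℕ.<_) y≡1+x m<y)))
    find (inj₂ ((.(toℕ x) , us) , o∈ , refl , r≡)) = (toℕ x , us) , o∈ , ⊆-antisym V⊆ ⊆V
      where
      bs   = proj₁ (branching* o∈)
      2≤us = proj₂ (branching* o∈)

      -- Membership in `V` is decidable, so it may be proved by contradiction; x and y do belong to
      -- `V`, hence a missing point lies strictly between them.
      present : ∀ {z i} → toℕ x ≤ z → z ≤ toℕ y → toℕ i ≡ z →
        ((∀ j → toℕ j ≡ z → j ∉ˢ V) → toℕ x ℕ.< z → z ℕ.< toℕ y → Empty.⊥) → i ∈ˢ V
      present {z} {i} x≤z z≤y i≡z absurd with i ∈? V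
      ... | yes i∈ = i∈
      ... | no i∉ = ⊥-elim (absurd (λ j j≡z j∈ → i∉ (subst (_∈ˢ V) (toℕ-injective (trans j≡z (sym i≡z))) j∈))
                      (ℕ.≤∧≢⇒< x≤z (λ x≡z → i∉ (subst (_∈ˢ V) (toℕ-injective (trans x≡z (sym i≡z))) x∈)))
                      (ℕ.≤∧≢⇒< z≤y (λ z≡y → i∉ (subst (_∈ˢ V) (toℕ-injective (trans (sym z≡y) (sym i≡z))) y∈))))

      -- If an end of the base of `o′` were missing from `V`, the side of `V` over it would cross
      -- that base or have `i` strictly under it. So both ends are in `V`, the base is a side of `V`
      -- by `inner`, and either `i` lies in its gap or the base spans all of [x, y].
      uncovered : ∀ {i o′} → i ∈ˢ V → o′ ∈ pieces* (toℕ x) us → left o′ ℕ.< toℕ i → toℕ i ℕ.< right o′ → Empty.⊥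
      uncovered {i} {o′} i∈ o′∈ p<i i<q with base-edge (pieces-trans 0 {t} o∈ o′∈)
      ... | p , q , p≡ , q≡ , e = conclude (proper (pieces-trans 0 {t} o∈ o′∈))
        where
        o′∈t = pieces-trans 0 {t} o∈ o′∈
        xp = proj₁ (pieces*-bounds (toℕ x) bs o′∈)
        qy = subst (right o′ ≤_) r≡ (proj₂ (proj₂ (pieces*-bounds (toℕ x) bs o′∈)))
        i≤y = proj₂ (inside i i∈)
        x≤i = proj₁ (inside i i∈)
        p∈ : p ∈ˢ V
        p∈ = present xp (ℕ.<⇒≤ (ℕ.<-≤-trans p<i i≤y)) p≡ λ p∉ x<p p<y → cross (over (left o′) x<p p<y p∉)
          where
          cross : ∃[ o″ ] (o″ ∈ pieces 0 t × Has V (left o″) × Has V (right o″) × left o″ ℕ.< left o′ ×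
              left o′ ℕ.< right o″ ×
            (∀ i → i ∈ˢ V → toℕ i ≤ left o″ ⊎ right o″ ≤ toℕ i)) → Empty.⊥
          cross (o″ , o″∈ , _ , _ , u<p , p<w , split) with split i i∈
          ... | inj₁ i≤u = ℕ.<⇒≱ (ℕ.<-trans u<p p<i) i≤u
          ... | inj₂ w≤i = pieces-¬crossing 0 branching o″∈ o′∈t (u<p , p<w , ℕ.≤-<-trans w≤i i<q)
        q∈ : q ∈ˢ V
        q∈ = present (ℕ.<⇒≤ (ℕ.≤-<-trans x≤i i<q)) qy q≡ λ q∉ x<q q<y → cross (over (right o′) x<q q<y q∉)
          where
          cross : ∃[ o″ ] (o″ ∈ pieces 0 t × Has V (left o″) × Has V (right o″) × left o″ ℕ.< right o′ ×
              right o′ ℕ.< right o″ ×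
            (∀ i → i ∈ˢ V → toℕ i ≤ left o″ ⊎ right o″ ≤ toℕ i)) → Empty.⊥
          cross (o″ , o″∈ , _ , _ , u<q , q<w , split) with split i i∈
          ... | inj₁ i≤u = pieces-¬crossing 0 branching o′∈t o″∈ (ℕ.<-≤-trans p<i i≤u , u<q , q<w)
          ... | inj₂ w≤i = ℕ.<⇒≱ (ℕ.<-trans i<q q<w) w≤i
        spans : left o′ ≤ toℕ x → toℕ y ≤ right o′ → Empty.⊥
        spans l r = pieces*-proper (toℕ x) 2≤us bs o′∈ (l , ℕ.≤-trans (ℕ.≤-reflexive r≡) r)
        proper : o′ ∈ pieces 0 t → o′ ∈ pieces* 0 rs
        proper (here refl) = ⊥-elim (spans z≤n (ℕ.≤-trans (ℕ.≤-pred (toℕ<n y)) (ℕ.≤-reflexive (sym end≡n))))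
        proper (there o′∈) = o′∈
        conclude : o′ ∈ pieces* 0 rs → Empty.⊥
        conclude o′∈rs with ∈-diagonals⁺ o′∈rs
        ... | p′ , q′ , p′≡ , q′≡ , pq∈
            with toℕ-injective {i = p′} {p} (trans p′≡ (sym p≡)) | toℕ-injective {i = q′} {q} (trans q′≡ (sym q≡))
        ... | refl | refl with proj₂ (proj₂ (proj₂ (inner p q pq∈ p∈ q∈)))
        ...   | inj₁ split with split i i∈
        ...     | inj₁ i≤p = ℕ.<⇒≱ p<i (subst (toℕ i ≤_) p≡ i≤p)
        ...     | inj₂ q≤i = ℕ.<⇒≱ i<q (subst (_≤ toℕ i) q≡ q≤i)
        conclude o′∈rs | p′ , q′ , p′≡ , q′≡ , pq∈ | refl | refl | inj₂ wrap =
          spans (subst (_≤ toℕ x) p≡ (proj₁ (wrap x x∈))) (subst (toℕ y ≤_) q≡ (proj₂ (wrap y y∈)))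

      V⊆ : ∀ {i} → i ∈ˢ V → i ∈ˢ support N (corners (toℕ x) us)
      V⊆ {i} i∈ with corner-or-covered (toℕ x) {us} (proj₁ (inside i i∈))
          (subst (toℕ i ≤_) (sym r≡) (proj₂ (inside i i∈)))
      ... | inj₁ c = ∈-support⁺ _ c
      ... | inj₂ (o′ , o′∈ , p<i , i<q) = ⊥-elim (uncovered i∈ o′∈ p<i i<q)

      ⊆V : ∀ {i} → i ∈ˢ support N (corners (toℕ x) us) → i ∈ˢ V
      -- The side of `V` over a missing corner would be the base of a piece nested in the given one:
      -- not a proper descendant, since these cover no corner, and not the piece itself, since the
      -- vertex `m` lies in between.
      ⊆V {i} i∈ = present (proj₁ bnd) (subst (toℕ i ≤_) r≡ (proj₂ bnd)) refl λ i∉ x<i i<y →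
          absurd (over (toℕ i) x<i i<y i∉)
        where
        c   = ∈-support⁻ (corners (toℕ x) us) i∈
        bnd = corners-bounds (toℕ x) bs c
        absurd : ∃[ o″ ] (o″ ∈ pieces 0 t × Has V (left o″) × Has V (right o″) × left o″ ℕ.< toℕ i ×
            toℕ i ℕ.< right o″ ×
            (∀ i → i ∈ˢ V → toℕ i ≤ left o″ ⊎ right o″ ≤ toℕ i)) → Empty.⊥
        absurd (o″ , o″∈ , (u , u≡ , u∈) , (w , w≡ , w∈) , u<i , i<w , split)
          with pieces-nested 0 branching o∈ o″∈ (subst (toℕ x ≤_) u≡ (proj₁ (inside u u∈)))
                 (ℕ.≤-trans (subst (_≤ toℕ y) w≡ (proj₂ (inside w w∈))) (ℕ.≤-reflexive (sym r≡)))
        ... | inj₂ o″∈us = Sum.[ ℕ.<⇒≱ u<i , ℕ.<⇒≱ i<w ] (corners-uncovered (toℕ x) bs o″∈us c)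
        ... | inj₁ refl with split m m∈
        ...   | inj₁ m≤x = ℕ.<⇒≱ x<m m≤x
        ...   | inj₂ y≤m = ℕ.<⇒≱ m<y (subst (_≤ toℕ m) r≡ y≤m)

-- Counting the pieces at a vertex

∈-subsets : ∀ {N} (V : Subset N) → V ∈ subsets N
∈-subsets []          = here refl
∈-subsets (true ∷ V)  = ∈-++⁺ˡ (∈-map⁺ (true ∷_) (∈-subsets V))
∈-subsets (false ∷ V) = ∈-++⁺ʳ _ (∈-map⁺ (false ∷_) (∈-subsets V))

subsets-unique : ∀ N → Unique (subsets N)
subsets-unique zero    = [] ∷ []
subsets-unique (suc N) = ++⁺ (map⁺ (proj₂ ∘ ∷-injective) (subsets-unique N))
    (map⁺ (proj₂ ∘ ∷-injective) (subsets-unique N)) disjoint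
  where
  disjoint : ∀ {V} → ¬ (V ∈ map (true ∷_) (subsets N) × V ∈ map (false ∷_) (subsets N))
  disjoint (p , q) with ∈-map⁻ (true ∷_) p | ∈-map⁻ (false ∷_) q
  ... | _ , _ , refl | _ , _ , ()

separated : ∀ {N o o′ z} → z ℕ.< N → z ∈ corners (left o) (proj₂ o) → z ∉ corners (left o′) (proj₂ o′) →
  vertices N o ≢ vertices N o′
separated {z = z} z<N z∈ z∉ eq = z∉ (subst (_∈ _) (toℕ-fromℕ< z<N)
  (∈-support⁻ _ (subst (Fin.fromℕ< z<N ∈ˢ_) eq (∈-support⁺ _ (subst (_∈ _) (sym (toℕ-fromℕ< z<N)) z∈)))))

-- No descendant has both ends of its ancestor's base as corners, and a piece of an earlier subtree
-- starts before every later subtree. Distinctness makes counting pieces the same as counting vertex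
-- sets.
pieces-distinct : ∀ {N} x {t} → Branching t → end x t ℕ.< N →
  AllPairs (λ o o′ → vertices N o ≢ vertices N o′) (pieces x t)
pieces*-distinct : ∀ {N} x {ts} → All Branching ts → end* x ts ℕ.< N →
  AllPairs (λ o o′ → vertices N o ≢ vertices N o′) (pieces* x ts)
pieces-distinct x leaf e< = []
pieces-distinct {N} x {node ts} (node p ps) e< = All.tabulate head ∷ pieces*-distinct x ps e<
  where
  head : ∀ {o′} → o′ ∈ pieces* x ts → vertices N (x , ts) ≢ vertices N o′
  head {o′} o′∈ with left o′ ℕ.≤? x
  ... | no l≰x = separated {o = x , ts} {o′} (ℕ.≤-<-trans (≤-end* x ps) e<) (left∈corners x ts)
          (λ x∈ → l≰x (proj₁ (corners-bounds _ (subtrees*-Every x ps o′∈) x∈)))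
  ... | yes l≤x = separated {o = x , ts} {o′} e< (right∈corners x ts)
          (λ e∈ → pieces*-proper x p ps o′∈ (l≤x , proj₂ (corners-bounds _ (subtrees*-Every x ps o′∈) e∈)))
pieces*-distinct x {[]} [] e< = []
pieces*-distinct {N} x {t ∷ ts} (p ∷ ps) e< =
  AllPairs.++⁺ (pieces-distinct x p (ℕ.≤-<-trans (≤-end* (end x t) ps) e<)) (pieces*-distinct (end x t) ps e<)
    (All.tabulate (λ o∈ → All.tabulate (λ o′∈ → across o∈ o′∈)))
  where
  across : ∀ {o o′} → o ∈ pieces x t → o′ ∈ pieces* (end x t) ts → vertices N o ≢ vertices N o′
  across {o} {o′} o∈ o′∈ = separated {o = o} {o′} (ℕ.<-≤-trans l<e (ℕ.<⇒≤ (ℕ.≤-<-trans (≤-end* (end x t) ps) e<)))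
    (left∈corners (left o) (proj₂ o))
    (λ l∈ → ℕ.<⇒≱ l<e (ℕ.≤-trans (proj₁ (pieces*-bounds (end x t) ps o′∈))
                                  (proj₁ (corners-bounds _ (subtrees*-Every _ ps o′∈) l∈))))
    where
    l<e : left o ℕ.< end x t
    l<e with pieces-bounds x p o∈
    ... | _ , l<r , r≤e = ℕ.<-≤-trans (ℕ.<-trans (ℕ.n<1+n _) l<r) r≤e

unique-set⇒↭ : ∀ {A : Set} {xs ys : List A} → Unique xs → Unique ys →
  (∀ {z} → z ∈ xs → z ∈ ys) → (∀ {z} → z ∈ ys → z ∈ xs) → xs ↭ ys
unique-set⇒↭ u v to from = ∼bag⇒↭ (unique∧set⇒bag u v (mk⇔ to from))

module _ {N} (D : Dissection N) where

  subpolygons-unique : Unique (subpolygons D)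
  subpolygons-unique = filter⁺ (isSubpolygon? D) (subsets-unique N)

  ∈-subpolygons⁺ : ∀ {V} → IsSubpolygon D V → V ∈ subpolygons D
  ∈-subpolygons⁺ {V} p = ∈-filter⁺ (isSubpolygon? D) (∈-subsets V) p

  ∈-subpolygons⁻ : ∀ {V} → V ∈ subpolygons D → IsSubpolygon D V
  ∈-subpolygons⁻ {V} V∈ = proj₂ (∈-filter⁻ (isSubpolygon? D) {v = V} {xs = subsets N} V∈)

module _ {n} {rs : List Tree} {D : Dissection (suc n)} (des : Describes rs D) where
  open Describes des

  -- One list is ordered by `subsets`, the other by the tree. Without repetitions, equal membership
  -- suffices to count them under any filter.
  subpolygons↭pieces : subpolygons D ↭ map (vertices (suc n)) (pieces 0 (node rs))
  subpolygons↭pieces = unique-set⇒↭ (subpolygons-unique D)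
    (AllPairs.map⁺ (pieces-distinct 0 {node rs} branching (s≤s (ℕ.≤-reflexive end≡n))))
    (λ V∈ → to (subpolygon⇒piece des (∈-subpolygons⁻ D V∈))) (λ V∈ → ∈-subpolygons⁺ D (from V∈))
    where
    to : ∀ {V} → ∃[ o ] (o ∈ pieces 0 (node rs) × V ≡ vertices (suc n) o) → V ∈ map (vertices (suc n))
        (pieces 0 (node rs))
    to (o , o∈ , refl) = ∈-map⁺ (vertices (suc n)) o∈
    from : ∀ {V} → V ∈ map (vertices (suc n)) (pieces 0 (node rs)) → IsSubpolygon D V
    from V∈ with ∈-map⁻ (vertices (suc n)) {xs = pieces 0 (node rs)} V∈
    ... | o , o∈ , refl = piece⇒subpolygon des o∈

-- Entries of a sequence read off its word

δ : ℕ → ℕ → ℕ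
δ i x = if does (i ℕ.≟ x) then 1 else 0

δ-≢ : ∀ {i x} → i ≢ x → δ i x ≡ 0
δ-≢ {i} {x} i≢x = cong (if_then 1 else 0) (dec-false (i ℕ.≟ x) i≢x)

δ-refl : ∀ x → δ x x ≡ 1
δ-refl x = cong (if_then 1 else 0) (dec-true (x ℕ.≟ x) refl)

-- The entry at vertex i of the sequence encoded by a word starting at vertex x.
entry : ℕ → Word → ℕ → ℕ
entry x []         i = 0
entry x (tick ∷ w) i = δ i x + entry x w i
entry x (step ∷ w) i = entry (suc x) w i

final : ℕ → Word → ℕ
final x []         = x
final x (tick ∷ w) = final x w
final x (step ∷ w) = final (suc x) w

entry-++ : ∀ x v w i → entry x (v ++ w) i ≡ entry x v i + entry (final x v) w i
entry-++ x []         w i = refl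
entry-++ x (tick ∷ v) w i = trans (cong (δ i x ℕ.+_) (entry-++ x v w i)) (sym (ℕ.+-assoc (δ i x) _ _))
entry-++ x (step ∷ v) w i = entry-++ (suc x) v w i

final-++ : ∀ x v w → final x (v ++ w) ≡ final (final x v) w
final-++ x []         w = refl
final-++ x (tick ∷ v) w = final-++ x v w
final-++ x (step ∷ v) w = final-++ (suc x) v w

final-word  : ∀ x t → final x (word t) ≡ end x t
final-word* : ∀ x ts → final x (word* ts) ≡ end* x ts
final-word x leaf      = refl
final-word x (node ts) = final-word* x ts
final-word* x []       = refl
final-word* x (t ∷ ts) = trans (final-++ x (word t) (word* ts))
    (trans (cong (λ y → final y (word* ts)) (final-word x t)) (final-word* (end x t) ts))

multiplicity : ℕ → List ℕ → ℕ
multiplicity i []       = 0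
multiplicity i (v ∷ vs) = δ i v + multiplicity i vs

multiplicity-∉ : ∀ {i} vs → i ∉ vs → multiplicity i vs ≡ 0
multiplicity-∉ []       i∉ = refl
multiplicity-∉ (v ∷ vs) i∉ = cong₂ _+_ (δ-≢ (i∉ ∘ here)) (multiplicity-∉ vs (i∉ ∘ there))

multiplicity-corners : ∀ {i} x {ts} → All Branching ts → i ∈ corners x ts → multiplicity i (corners x ts) ≡ 1
multiplicity-corners {i} x {[]}     []       (here refl) = cong (_+ 0) (δ-refl x)
multiplicity-corners {i} x {t ∷ ts} (p ∷ ps) (here refl) =
  cong₂ _+_ (δ-refl x) (multiplicity-∉ _ (λ x∈ → ℕ.<⇒≱ (<-end x p) (proj₁ (corners-bounds (end x t) ps x∈))))
multiplicity-corners {i} x {t ∷ ts} (p ∷ ps) (there i∈)  =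
  cong₂ _+_ (δ-≢ (λ i≡x → ℕ.<⇒≱ (<-end x p) (subst (end x t ≤_) i≡x (proj₁ (corners-bounds (end x t) ps i∈)))))
    (multiplicity-corners (end x t) ps i∈)

HasCorner : ℕ → Piece → Set
HasCorner i (x , ts) = i ∈ corners x ts

hasCorner? : ∀ i → Decidable (HasCorner i)
hasCorner? i (x , ts) = member? ℕ._≟_ i (corners x ts)

incident : ℕ → List Piece → ℕ
incident i os = length (filter (hasCorner? i) os)

incident-++ : ∀ i os os′ → incident i (os ++ os′) ≡ incident i os + incident i os′
incident-++ i os os′ = trans (cong length (filter-++ (hasCorner? i) os os′)) (length-++ (filter (hasCorner? i) os))

-- The corners of a node are pairwise distinct, so a node adds 1 at each of them. In the version for
-- forests the surrounding node is counted apart, through `multiplicity`.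
entry-word  : ∀ x {t} → Branching t → ∀ i → entry x (word t) i ≡ incident i (pieces x t)
entry-word* : ∀ x {ts} → All Branching ts → ∀ i → entry x (word* ts) i ≡ multiplicity i
    (corners x ts) + incident i (pieces* x ts)
entry-word x leaf i = refl
entry-word x {node ts} (node _ ps) i with member? ℕ._≟_ i (corners x ts)
... | yes i∈ = trans (entry-word* x ps i) (cong (_+ incident i (pieces* x ts)) (multiplicity-corners x ps i∈))
... | no i∉  = trans (entry-word* x ps i) (cong (_+ incident i (pieces* x ts)) (multiplicity-∉ _ i∉))
entry-word* x [] i = sym (ℕ.+-identityʳ _)
entry-word* x {t ∷ ts} (p ∷ ps) i = begin
  δ i x + entry x (word t ++ word* ts) i
    ≡⟨ cong (δ i x ℕ.+_) (entry-++ x (word t) (word* ts) i) ⟩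
  δ i x + (entry x (word t) i + entry (final x (word t)) (word* ts) i)
    ≡⟨ cong₂ (λ a y → δ i x + (a + entry y (word* ts) i)) (entry-word x p i) (final-word x t) ⟩
  δ i x + (incident i (pieces x t) + entry (end x t) (word* ts) i)
    ≡⟨ cong (λ a → δ i x + (incident i (pieces x t) + a)) (entry-word* (end x t) ps i) ⟩
  δ i x + (incident i (pieces x t) + (multiplicity i (corners (end x t) ts) + incident i (pieces* (end x t) ts)))
    ≡⟨ shuffle (δ i x) (incident i (pieces x t)) _ _ ⟩
  δ i x + multiplicity i (corners (end x t) ts) + (incident i (pieces x t) + incident i (pieces* (end x t) ts))
    ≡⟨ cong (δ i x + multiplicity i (corners (end x t) ts) ℕ.+_) (incident-++ i (pieces x t) _) ⟨
  δ i x + multiplicity i (corners (end x t) ts) + incident i (pieces x t ++ pieces* (end x t) ts) ∎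
  where
  open ≡-Reasoning
  shuffle : ∀ a b c d → a + (b + (c + d)) ≡ a + c + (b + d)
  shuffle = ℕ-Solver.solve-∀

length-filter-map : ∀ {A B : Set} {P : Pred B 0ℓ} {Q : Pred A 0ℓ} (P? : Decidable P) (Q? : Decidable Q)
    (f : A → B) {xs} →
  All (λ x → P (f x) ⇔ Q x) xs → length (filter P? (map f xs)) ≡ length (filter Q? xs)
length-filter-map P? Q? f [] = refl
length-filter-map P? Q? f {x ∷ xs} (e ∷ es) with P? (f x) | Q? x
... | yes _ | yes _ = cong suc (length-filter-map P? Q? f es)
... | no _  | no _  = length-filter-map P? Q? f es
... | yes p | no ¬q = ⊥-elim (¬q (Equivalence.to e p))
... | no ¬p | yes q = ⊥-elim (¬p (Equivalence.from e q))

¬3∣4 : ¬ 3 ∣ 4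
¬3∣4 = from-no (3 ∣? 4)

∣vertices∣ : ∀ {n rs} {D : Dissection (suc n)} → Describes rs D → ∀ {o} → o ∈ pieces 0 (node rs) →
  ∣ vertices (suc n) o ∣ ≡ suc (length (proj₂ o))
∣vertices∣ {rs = rs} des {o} o∈ = ∣corners∣ _ _ (subtrees-Every {t = node rs} 0 branching o∈)
  (s≤s (ℕ.≤-trans (proj₂ (proj₂ (pieces-bounds 0 branching o∈))) (ℕ.≤-reflexive end≡n)))
  where open Describes des

-- The root has 4 vertices and fails the divisibility test, while all other pieces pass it. The leaf
-- over [0, 1] contains no piece, so the word may start at vertex 1.
count3d≡entry : ∀ {n t₁ t₂} {D : Dissection (suc n)} → Describes (leaf ∷ t₁ ∷ t₂ ∷ []) D →
  Every Ternary t₁ → Every Ternary t₂ → ∀ i → count3d D i ≡ entry 1 (word t₁ ++ word t₂) (toℕ i)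
count3d≡entry {n} {t₁} {t₂} {D} des e₁ e₂ i = begin
  length (filter Q? (subpolygons D))
    ≡⟨ ↭-length (filter-↭ Q? (subpolygons↭pieces des)) ⟩
  length (filter Q? (vertices N root ∷ map (vertices N) os))
    ≡⟨ cong length (filter-reject Q? {x = vertices N root} {xs = map (vertices N) os}
        (λ q → ¬3∣4 (subst (3 ∣_) root-size (proj₁ q)))) ⟩
  length (filter Q? (map (vertices N) os))
    ≡⟨ length-filter-map Q? (hasCorner? (toℕ i)) (vertices N) (All.tabulate Q⇔) ⟩
  incident (toℕ i) (pieces 1 t₁ ++ pieces* (end 1 t₁) (t₂ ∷ []))
    ≡⟨ incident-++ (toℕ i) (pieces 1 t₁) _ ⟩
  incident (toℕ i) (pieces 1 t₁) + incident (toℕ i) (pieces* (end 1 t₁) (t₂ ∷ []))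
    ≡⟨ cong (λ z → incident (toℕ i) (pieces 1 t₁) + z) (trans
        (incident-++ (toℕ i) (pieces (end 1 t₁) t₂) []) (ℕ.+-identityʳ _)) ⟩
  incident (toℕ i) (pieces 1 t₁) + incident (toℕ i) (pieces (end 1 t₁) t₂)
    ≡⟨ cong₂ _+_ (entry-word 1 b₁ (toℕ i)) (entry-word (end 1 t₁) b₂ (toℕ i)) ⟨
  entry 1 (word t₁) (toℕ i) + entry (end 1 t₁) (word t₂) (toℕ i)
    ≡⟨ cong (λ y → entry 1 (word t₁) (toℕ i) + entry y (word t₂) (toℕ i)) (final-word 1 t₁) ⟨
  entry 1 (word t₁) (toℕ i) + entry (final 1 (word t₁)) (word t₂) (toℕ i)
    ≡⟨ entry-++ 1 (word t₁) (word t₂) (toℕ i) ⟨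
  entry 1 (word t₁ ++ word t₂) (toℕ i) ∎
  where
  open ≡-Reasoning
  N = suc n
  root : Piece
  root = 0 , leaf ∷ t₁ ∷ t₂ ∷ []
  os : List Piece
  os = pieces* 0 (leaf ∷ t₁ ∷ t₂ ∷ [])
  b₁ = Every-map ternary⇒2≤ e₁
  b₂ = Every-map ternary⇒2≤ e₂
  Q : Subset N → Set
  Q V = 3 ∣ ∣ V ∣ × i ∈ˢ V
  Q? : Decidable Q
  Q? V = (3 ∣? ∣ V ∣) ×-dec (i ∈? V)
  root-size : ∣ vertices N root ∣ ≡ 4
  root-size = ∣vertices∣ des {root} (here refl)
  Q⇔ : ∀ {o} → o ∈ os → Q (vertices N o) ⇔ HasCorner (toℕ i) o
  Q⇔ {o} o∈ = mk⇔ (λ q → ∈-support⁻ _ (proj₂ q)) (λ c → subst (3 ∣_) (sym (∣vertices∣ des (there o∈)))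
      (pieces*-Every 0 (leaf ∷ e₁ ∷ e₂ ∷ []) o∈) , ∈-support⁺ _ c)

-- The tree of a dissection

module _ (Diag : ℕ → ℕ → Set) (diag? : ∀ p q → Dec (Diag p q))
         (diag-long : ∀ {p q} → Diag p q → suc p ℕ.< q)
         (diag-¬crossing : ∀ {p q r s} → Diag p q → Diag r s → ¬ (p ℕ.< r × r ℕ.< q × q ℕ.< s)) where

  HasPiece : List Piece → ℕ → ℕ → Set
  HasPiece os p q = ∃[ o ] (o ∈ os × left o ≡ p × right o ≡ q)

  -- The bound `b` concerns only diagonals starting at `x`. Under a base [x, y] it is y - 1, which
  -- leaves out the base itself; for the remaining corners it is `y`.
  record Trees (x b y : ℕ) : Set where
    field
      trees     : List Tree
      ends      : end* x trees ≡ y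
      branching : All Branching trees
      sound     : ∀ {o} → o ∈ pieces* x trees → Diag (left o) (right o)
      complete  : ∀ {p q} → Diag p q → x ≤ p → q ≤ y → (p ≡ x → q ≤ b) → HasPiece (pieces* x trees) p q

  record TreeOver (x y : ℕ) : Set where
    field
      tree      : Tree
      ends      : end x tree ≡ y
      branching : Branching tree
      sound     : ∀ {o} → o ∈ pieces x tree → (left o ≡ x × right o ≡ y) ⊎ Diag (left o) (right o)
      complete  : ∀ {p q} → Diag p q → x ≤ p → q ≤ y → HasPiece (pieces x tree) p q

  Link : ℕ → ℕ → Set
  Link u m = m ≡ suc u ⊎ Diag u m

  link? : ∀ u m → Dec (Link u m)
  link? u m = (m ℕ.≟ suc u) ⊎-dec diag? u m

  -- The next corner `m` is the farthest point linked to `x` within the bound. A diagonal starting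
  -- before `m` then ends by `m`: one from `x` by maximality, one from inside because it would cross
  -- [x, m].
  prepend : ∀ {x m b y} → m ≤ b → m ≤ y → Link x m → (∀ q → q ≤ b → Link x q → q ≤ m) →
    TreeOver x m → Trees m y y → Trees x b y
  prepend {x} {m} {b} {y} m≤b m≤y link max H L = record
    { trees     = Hd.tree ∷ Tl.trees
    ; ends      = trans (cong (λ z → end* z Tl.trees) Hd.ends) Tl.ends
    ; branching = Hd.branching ∷ Tl.branching
    ; sound     = sound
    ; complete  = complete
    }
    where
    module Hd = TreeOver H
    module Tl = Trees L
    sound : ∀ {o} → o ∈ pieces x Hd.tree ++ pieces* (end x Hd.tree) Tl.trees → Diag (left o) (right o)
    sound {o} o∈ with ∈-++⁻ (pieces x Hd.tree) o∈
    ... | inj₂ o∈L = Tl.sound (subst (λ z → o ∈ pieces* z Tl.trees) Hd.ends o∈L)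
    ... | inj₁ o∈H with Hd.sound o∈H
    ...   | inj₂ d = d
    ...   | inj₁ (l≡x , r≡m) = Sum.[
              (λ m≡1+x → ⊥-elim (ℕ.<-irrefl (trans (cong suc l≡x) (trans (sym m≡1+x) (sym r≡m)))
                           (proj₁ (proj₂ (pieces-bounds x Hd.branching o∈H)))))
            , subst₂ Diag (sym l≡x) (sym r≡m) ] link
    complete : ∀ {p q} → Diag p q → x ≤ p → q ≤ y → (p ≡ x → q ≤ b) →
      HasPiece (pieces x Hd.tree ++ pieces* (end x Hd.tree) Tl.trees) p q
    complete {p} {q} d x≤p q≤y p≡x⇒ with p ℕ.<? m
    ... | no p≮m with Tl.complete d (ℕ.≮⇒≥ p≮m) q≤y (λ _ → q≤y)
    ...   | o , o∈ , eqs = o , ∈-++⁺ʳ (pieces x Hd.tree)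
        (subst (λ z → o ∈ pieces* z Tl.trees) (sym Hd.ends) o∈) , eqs
    complete {p} {q} d x≤p q≤y p≡x⇒ | yes p<m with Hd.complete d x≤p q≤m
      where
      q≤m : q ≤ m
      q≤m with ℕ.m≤n⇒m<n∨m≡n x≤p
      ... | inj₂ refl = max q (p≡x⇒ refl) (inj₂ d)
      ... | inj₁ x<p = Sum.[
              (λ m≡1+x → ⊥-elim (ℕ.<⇒≱ x<p (ℕ.≤-pred (subst (p ℕ.<_) m≡1+x p<m))))
            , (λ d′ → ℕ.≮⇒≥ (λ m<q → diag-¬crossing d′ d (x<p , p<m , m<q))) ] link
    ...   | o , o∈ , eqs = o , ∈-++⁺ˡ o∈ , eqs

  -- The numbers `k` and `l` serve termination: `k` bounds the length of the interval and drops on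
  -- passing to the subtrees of a node, `l` drops from one corner of the node to the next.
  treeOver  : ∀ k x y → x ℕ.< y → y ≤ x + k → TreeOver x y
  treesUnder : ∀ k x y → suc x ℕ.< y → y ≤ x + k → Σ[ F ∈ Trees x (ℕ.pred y) y ] 2 ≤ length (Trees.trees F)
  treesFrom : ∀ k l u y → u ≤ y → y ≤ u + l → y ≤ u + k → Trees u y y

  treeOver k x y x<y y≤ with ℕ.m≤n⇒m<n∨m≡n x<y
  ... | inj₂ refl = record
    { tree = leaf ; ends = refl ; branching = leaf ; sound = λ ()
    ; complete = λ d x≤p q≤y → ⊥-elim (ℕ.<⇒≱ (diag-long d) (ℕ.≤-trans q≤y (s≤s x≤p))) }
  ... | inj₁ 1+x<y with treesUnder k x y 1+x<y y≤
  ...   | F , 2≤ = record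
    { tree = node F.trees ; ends = F.ends ; branching = node 2≤ F.branching ; sound = sound ; complete = complete }
    where
    module F = Trees F
    sound : ∀ {o} → o ∈ pieces x (node F.trees) → (left o ≡ x × right o ≡ y) ⊎ Diag (left o) (right o)
    sound (here refl) = inj₁ (refl , F.ends)
    sound (there o∈)  = inj₂ (F.sound o∈)
    complete : ∀ {p q} → Diag p q → x ≤ p → q ≤ y → HasPiece (pieces x (node F.trees)) p q
    complete {p} {q} d x≤p q≤y with (p ℕ.≟ x) ×-dec (q ℕ.≟ y)
    ... | yes (refl , refl) = (x , F.trees) , here refl , refl , F.ends
    ... | no ≢ with F.complete d x≤p q≤y (λ p≡x → ℕ.<⇒≤pred (ℕ.≤∧≢⇒< q≤y (λ q≡y → ≢ (p≡x , q≡y))))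
    ...   | o , o∈ , eqs = o , there o∈ , eqs

  treesUnder zero x y 1+x<y y≤ = ⊥-elim (ℕ.<⇒≱ 1+x<y (ℕ.≤-trans y≤ (ℕ.≤-trans
      (ℕ.≤-reflexive (ℕ.+-identityʳ x)) (ℕ.n≤1+n x))))
  -- Searching only up to `y` excludes the base [x, y + 1], so the first subtree stops short of the
  -- right end and a second one exists.
  treesUnder (suc k) x (suc y) (s≤s x<y) y≤ with greatest (link? x) y x<y (inj₁ refl)
  ... | m , x<m , m≤y , link , max =
    prepend m≤y (ℕ.m≤n⇒m≤1+n m≤y) link max (treeOver k x m x<m (ℕ.≤-trans m≤y y≤x+k)) rest , s≤s nonempty
    where
    y≤x+k : y ≤ x + k
    y≤x+k = ℕ.≤-pred (subst (suc y ≤_) (ℕ.+-suc x k) y≤)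
    rest : Trees m (suc y) (suc y)
    rest = treesFrom k (suc k) m (suc y) (ℕ.m≤n⇒m≤1+n m≤y)
      (ℕ.≤-trans y≤ (ℕ.+-monoˡ-≤ (suc k) (ℕ.<⇒≤ x<m)))
      (ℕ.≤-trans (s≤s y≤x+k) (ℕ.+-monoˡ-≤ k x<m))
    nonempty : 1 ≤ length (Trees.trees rest)
    nonempty with Trees.trees rest | Trees.ends rest
    ... | []    | m≡1+y = ⊥-elim (ℕ.<⇒≱ (s≤s m≤y) (ℕ.≤-reflexive (sym m≡1+y)))
    ... | _ ∷ _ | _     = s≤s z≤n

  treesFrom k l u y u≤y y≤l y≤k with ℕ.m≤n⇒m<n∨m≡n u≤y
  ... | inj₂ refl = record
    { trees = [] ; ends = refl ; branching = [] ; sound = λ ()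
    ; complete = λ d u≤p q≤u _ → ⊥-elim (ℕ.<⇒≱ (ℕ.<-trans (ℕ.n<1+n _) (diag-long d)) (ℕ.≤-trans q≤u u≤p)) }
  treesFrom k zero u y u≤y y≤l y≤k | inj₁ u<y = ⊥-elim (ℕ.<⇒≱ u<y (subst (y ≤_) (ℕ.+-identityʳ u) y≤l))
  treesFrom k (suc l) u y u≤y y≤l y≤k | inj₁ u<y with greatest (link? u) y u<y (inj₁ refl)
  ... | m , u<m , m≤y , link , max =
    prepend m≤y m≤y link max (treeOver k u m u<m (ℕ.≤-trans m≤y y≤k))
      (treesFrom k l m y m≤y
        (ℕ.≤-trans (subst (y ≤_) (ℕ.+-suc u l) y≤l) (ℕ.+-monoˡ-≤ l u<m))
        (ℕ.≤-trans y≤k (ℕ.+-monoˡ-≤ k (ℕ.<⇒≤ u<m))))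

describe : ∀ {n} → 2 ≤ n → (D : Dissection (suc n)) → ∃[ rs ] Describes rs D
describe {n} 2≤n D = rs , record
  { branching    = node (proj₂ built) F.branching
  ; end≡n        = F.ends
  ; ∈-diagonals⁻ = ∈⁻
  ; ∈-diagonals⁺ = F.sound
  }
  where
  Diag : ℕ → ℕ → Set
  Diag p q = ∃[ i ] ∃[ j ] (toℕ i ≡ p × toℕ j ≡ q × (i , j) ∈ diagonals D)
  diag? : ∀ p q → Dec (Diag p q)
  diag? p q = any? λ i → any? λ j → (toℕ i ℕ.≟ p) ×-dec ((toℕ j ℕ.≟ q) ×-dec ((i , j) ∈ₗ? diagonals D))
  long : ∀ {p q} → Diag p q → suc p ℕ.< q
  long (i , j , refl , refl , ij∈) with areDiagonal D i j ij∈
  ... | i<j , ¬side = ℕ.≤∧≢⇒< i<j (λ eq → ¬side (⊤-side-suc (sym eq)))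
  ¬crossing : ∀ {p q r s} → Diag p q → Diag r s → ¬ (p ℕ.< r × r ℕ.< q × q ℕ.< s)
  ¬crossing (i , j , refl , refl , ij∈) (k , l , refl , refl , kl∈) = nonCrossing D i j k l ij∈ kl∈
  built = treesUnder Diag diag? long ¬crossing n 0 n 2≤n ℕ.≤-refl
  module F = Trees (proj₁ built)
  rs = F.trees
  ∈⁻ : ∀ {i j} → (i , j) ∈ diagonals D → ∃[ o ] (o ∈ pieces* 0 rs × left o ≡ toℕ i × right o ≡ toℕ j)
  ∈⁻ {i} {j} ij∈ = F.complete (i , j , refl , refl , ij∈) z≤n (ℕ.≤-pred (toℕ<n j)) below
    where
    -- A diagonal from 0 cannot reach n, since [0, n] is a side.
    below : toℕ i ≡ 0 → toℕ j ≤ ℕ.pred n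
    below i≡0 = ℕ.<⇒≤pred (ℕ.≤∧≢⇒< (ℕ.≤-pred (toℕ<n j))
      (λ j≡n → proj₂ (areDiagonal D i j ij∈) (⊤-side-wrap (ℕ.<⇒≤ 2≤n) i≡0 j≡n)))

-- Solutions and notched dissections

final-≥ : ∀ x w → x ≤ final x w
final-≥ x []         = ℕ.≤-refl
final-≥ x (tick ∷ w) = final-≥ x w
final-≥ x (step ∷ w) = ℕ.≤-trans (ℕ.n≤1+n x) (final-≥ (suc x) w)

entry-before : ∀ x w {i} → i ℕ.< x → entry x w i ≡ 0
entry-before x []         i<x = refl
entry-before x (tick ∷ w) i<x = cong₂ _+_ (δ-≢ (ℕ.<⇒≢ i<x)) (entry-before x w i<x)
entry-before x (step ∷ w) i<x = entry-before (suc x) w (ℕ.m<n⇒m<1+n i<x)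

entry-step-head : ∀ x w → entry (suc x) w (x + 0) ≡ 0
entry-step-head x w = entry-before (suc x) w (s≤s (ℕ.≤-reflexive (ℕ.+-identityʳ x)))

δ-head : ∀ x → δ (x + 0) x ≡ 1
δ-head x = trans (cong (λ i → δ i x) (ℕ.+-identityʳ x)) (δ-refl x)

δ-tail : ∀ x j → δ (x + suc j) x ≡ 0
δ-tail x j = δ-≢ (λ eq → ℕ.m+1+n≢m x eq)

M₁ : ℤ → Mat₂
M₁ a = ⟦ a , -1ℤ ⨾ 1ℤ , 0ℤ ⟧

M₁-suc : ∀ k → M₁ (+ suc k) ≡ M₁ (+ k) · T
M₁-suc k = sym (trans (·T≡ (+ k) -1ℤ 1ℤ 0ℤ) (mat-≡ (cong +_ (ℕ.+-comm k 1)) refl refl refl))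

M-word : ∀ w x m (a : Vec ℤ (suc m)) → final x w ≡ x + m →
  (∀ i → lookup a i ≡ + entry x w (x + toℕ i)) → S · M a ≈ φ w
M-word [] x (suc m) a x≡ ent = ⊥-elim (ℕ.m+1+n≢m x (sym x≡))
M-word [] x zero (a₀ ∷ []) x≡ ent with ent zero
... | refl = inj₂ refl
M-word (step ∷ w) x zero a x≡ ent =
  ⊥-elim (ℕ.<⇒≱ (final-≥ (suc x) w) (ℕ.≤-reflexive (trans x≡ (ℕ.+-identityʳ x))))
M-word (step ∷ w) x (suc m) (a₀ ∷ as) x≡ ent with trans (ent zero) (cong +_ (entry-step-head x w))
... | refl = ≈-trans (inj₁ (sym (·-assoc S (M as) S)))
  (·-cong-≈ (M-word w (suc x) m as (trans x≡ (ℕ.+-suc x m))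
    (λ i → trans (ent (suc i)) (cong (λ j → + entry (suc x) w j) (ℕ.+-suc x (toℕ i))))) (≈-refl {S}))
M-word (tick ∷ w) x m (a₀ ∷ as) x≡ ent =
  ≈-trans (inj₁ split) (·-cong-≈ (M-word w x m (+ e ∷ as) x≡ ent′) (≈-refl {T}))
  where
  e : ℕ
  e = entry x w (x + 0)
  a₀≡ : a₀ ≡ + suc e
  a₀≡ = trans (ent zero) (cong (λ d → + (d + e)) (δ-head x))
  split : S · (M as · M₁ a₀) ≡ S · (M as · M₁ (+ e)) · T
  split = trans (cong (λ z → S · (M as · z)) (trans (cong M₁ a₀≡) (M₁-suc e)))
         (trans (cong (S ·_) (sym (·-assoc (M as) (M₁ (+ e)) T))) (sym (·-assoc S (M as · M₁ (+ e)) T)))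
  ent′ : ∀ i → lookup (+ e ∷ as) i ≡ + entry x w (x + toℕ i)
  ent′ zero    = refl
  ent′ (suc i) = trans (ent (suc i)) (cong (λ d → + (d + entry x w (x + suc (toℕ i)))) (δ-tail x (toℕ i)))

-- The arguments are the entries minus one: the first `tick` at a vertex comes from `next`, or
-- precedes all moves, and `again` supplies the others.
moves : ∀ {m} → ℕ → Vec ℕ m → List Move
moves zero    []       = []
moves zero    (k ∷ ks) = next ∷ moves k ks
moves (suc k) ks       = again ∷ moves k ks

moves-final : ∀ {m} k (ks : Vec ℕ m) x → final x (tick ∷ unfold (moves k ks)) ≡ x + m
moves-final zero    []       x = sym (ℕ.+-identityʳ x)
moves-final {suc m} zero (k ∷ ks) x = trans (moves-final k ks (suc x)) (sym (ℕ.+-suc x m))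
moves-final (suc k) ks       x = moves-final k ks x

moves-entry : ∀ {m} k (ks : Vec ℕ m) x i →
  entry x (tick ∷ unfold (moves k ks)) (x + toℕ i) ≡ suc (lookup (k ∷ ks) i)
moves-entry zero    []       x zero    = cong (_+ 0) (δ-head x)
moves-entry zero    (k ∷ ks) x zero    = cong₂ _+_ (δ-head x) (entry-step-head x (tick ∷ unfold (moves k ks)))
moves-entry zero    (k ∷ ks) x (suc i) = cong₂ _+_ (δ-tail x (toℕ i))
  (trans (cong (entry (suc x) (tick ∷ unfold (moves k ks))) (ℕ.+-suc x (toℕ i))) (moves-entry k ks (suc x) i))
moves-entry (suc k) ks       x zero    = cong₂ _+_ (δ-head x) (moves-entry k ks x zero)
moves-entry (suc k) ks       x (suc i) = cong₂ _+_ (δ-tail x (toℕ i)) (moves-entry k ks x (suc i))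

predecessors : ∀ {m} (a : Vec ℤ m) → (∀ i → 0ℤ < lookup a i) → ∃[ ks ] (∀ i → lookup a i ≡ + suc (lookup ks i))
predecessors []       pos = [] , λ ()
predecessors (a ∷ as) pos with predecessors as (λ i → pos (suc i)) | pos zero
... | ks , eqs | ℤ.+<+ {n = suc k} _ = k ∷ ks , λ { zero → refl ; (suc i) → eqs i }

-- From two trees to a notched dissection

clamp : ∀ n → ℕ → Fin (suc n)
clamp zero    _       = zero
clamp (suc n) zero    = zero
clamp (suc n) (suc z) = suc (clamp n z)

toℕ-clamp : ∀ {n z} → z ≤ n → toℕ (clamp n z) ≡ z
toℕ-clamp {zero}  z≤n       = refl
toℕ-clamp {suc n} z≤n       = refl
toℕ-clamp {suc n} (s≤s p) = cong suc (toℕ-clamp p)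

realize : ∀ {n rs} → Branching (node rs) → end* 0 rs ≡ n → Σ[ D ∈ Dissection (suc n) ] Describes rs D
realize {n} {rs} br@(node 2≤ bs) refl = D , record { branching = br ; end≡n =
    refl ; ∈-diagonals⁻ = ∈⁻ ; ∈-diagonals⁺ = ∈⁺ }
  where
  -- `clamp` makes this total, so that it can be mapped over the list; the bounds on pieces keep all
  -- the values used in range.
  segment : Piece → Fin (suc n) × Fin (suc n)
  segment o = clamp n (left o) , clamp n (right o)

  segment-left : ∀ {o} → o ∈ pieces* 0 rs → toℕ (clamp n (left o)) ≡ left o
  segment-left o∈ with pieces*-bounds 0 bs o∈
  ... | _ , l<r , r≤n = toℕ-clamp (ℕ.≤-trans (ℕ.<⇒≤ (ℕ.<-trans (ℕ.n<1+n _) l<r)) r≤n)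

  segment-right : ∀ {o} → o ∈ pieces* 0 rs → toℕ (clamp n (right o)) ≡ right o
  segment-right o∈ = toℕ-clamp (proj₂ (proj₂ (pieces*-bounds 0 bs o∈)))

  segments : List (Fin (suc n) × Fin (suc n))
  segments = map segment (pieces* 0 rs)

  ∈⁻ : ∀ {i j} → (i , j) ∈ segments → ∃[ o ] (o ∈ pieces* 0 rs × left o ≡ toℕ i × right o ≡ toℕ j)
  ∈⁻ ij∈ with ∈-map⁻ segment ij∈
  ... | o , o∈ , refl = o , o∈ , sym (segment-left o∈) , sym (segment-right o∈)

  ∈⁺ : ∀ {o} → o ∈ pieces* 0 rs → ∃[ i ] ∃[ j ] (toℕ i ≡ left o × toℕ j ≡ right o × (i , j) ∈ segments)
  ∈⁺ {o} o∈ = clamp n (left o) , clamp n (right o) , segment-left o∈ , segment-right o∈ , ∈-map⁺ segment o∈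

  diagonal : ∀ i j → (i , j) ∈ segments → IsDiagonal i j
  diagonal i j ij∈ with ∈⁻ ij∈
  ... | o , o∈ , l≡ , r≡ = ℕ.<-trans (ℕ.n<1+n _) 1+i<j , ¬side
    where
    1+i<j : suc (toℕ i) ℕ.< toℕ j
    1+i<j = subst₂ (λ p q → suc p ℕ.< q) l≡ r≡ (proj₁ (proj₂ (pieces*-bounds 0 bs o∈)))
    ¬side : ¬ IsSide ⊤ i j
    ¬side s with ⊤-side⁻ s
    ... | inj₁ j≡1+i = ℕ.<-irrefl (sym j≡1+i) 1+i<j
    ... | inj₂ (i≡0 , j≡n) = pieces*-proper 0 2≤ bs o∈
      (ℕ.≤-reflexive (trans l≡ i≡0) , ℕ.≤-reflexive (sym (trans r≡ j≡n)))

  ¬crossing : ∀ x y z w → (x , y) ∈ segments → (z , w) ∈ segments → ¬ (x Fin.< z × z Fin.< y × y Fin.< w)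
  ¬crossing x y z w xy∈ zw∈ (x<z , z<y , y<w) with ∈⁻ xy∈ | ∈⁻ zw∈
  ... | o , o∈ , l≡ , r≡ | o′ , o′∈ , l′≡ , r′≡ = pieces*-¬crossing 0 bs o∈ o′∈
    (subst₂ ℕ._<_ (sym l≡) (sym l′≡) x<z , subst₂ ℕ._<_ (sym l′≡) (sym r≡) z<y , subst₂ ℕ._<_ (sym r≡)
        (sym r′≡) y<w)

  D : Dissection (suc n)
  D = record { diagonals = segments ; areDiagonal = diagonal ; nonCrossing = ¬crossing }

notched : ∀ {f g n} {D : Dissection (suc n)} → Describes (leaf ∷ node f ∷ node g ∷ []) D →
  Every Ternary (node f) → Every Ternary (node g) → Σ[ E ∈ NotchedDissection n ] dissection E ≡ D
notched {f} {g} {n} {D} des ef eg = E , refl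
  where
  open Describes des using () renaming (end≡n to eq)
  t₁ = node f
  t₂ = node g
  rs : List Tree
  rs = leaf ∷ t₁ ∷ t₂ ∷ []
  b₁ = Every-map ternary⇒2≤ ef
  b₂ = Every-map ternary⇒2≤ eg
  root : Piece
  root = 0 , rs
  V = vertices (suc n) root
  j = end 1 t₁

  long : ∀ x {t} → Branching (node t) → suc x ℕ.< end x (node t)
  long x (node 2≤ bs) = <-end* x 2≤ bs

  3≤j : 3 ≤ j
  3≤j = long 1 b₁
  2+j≤n : 2 + j ≤ n
  2+j≤n = subst (2 + j ≤_) eq (long j b₂)
  -- One step for the leaf and at least two for each of the two glued polygons.
  5≤n′ : 5 ≤ n
  5≤n′ = ℕ.≤-trans (s≤s (s≤s 3≤j)) 2+j≤n

  size : ∣ V ∣ ≡ 4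
  size = ∣vertices∣ des {root} (here refl)

  corner : ∀ {i : Fin (suc n)} → toℕ i ∈ corners 0 rs → i ∈ˢ V
  corner = ∈-support⁺ (corners 0 rs)

  others : ∀ {o} → o ∈ pieces* 0 rs → 3 ∣ ∣ vertices (suc n) o ∣
  others o∈ = subst (3 ∣_) (sym (∣vertices∣ des (there o∈))) (pieces*-Every 0 (leaf ∷ ef ∷ eg ∷ []) o∈)

  unique : ∀ W → IsSubpolygon D W → ∣ W ∣ ≡ 4 → W ≡ V
  unique W sub ∣W∣≡4 = go (subpolygon⇒piece des sub)
    where
    go : ∃[ o ] (o ∈ pieces 0 (node rs) × W ≡ vertices (suc n) o) → W ≡ V
    go (o , here refl , W≡) = W≡
    go (o , there o∈ , W≡)  = ⊥-elim (¬3∣4 (subst (3 ∣_) (trans (cong ∣_∣ (sym W≡)) ∣W∣≡4) (others o∈)))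

  multiple : ∀ W → IsSubpolygon D W → W ≢ V → 3 ∣ ∣ W ∣
  multiple W sub W≢V = go (subpolygon⇒piece des sub)
    where
    go : ∃[ o ] (o ∈ pieces 0 (node rs) × W ≡ vertices (suc n) o) → 3 ∣ ∣ W ∣
    go (o , here refl , W≡) = ⊥-elim (W≢V W≡)
    go (o , there o∈ , W≡)  = subst (λ X → 3 ∣ ∣ X ∣) (sym W≡) (others o∈)

  u v : Fin (suc n)
  u = clamp n 1
  v = clamp n n
  u≡1 : toℕ u ≡ 1
  u≡1 = toℕ-clamp (ℕ.≤-trans (s≤s z≤n) 5≤n′)
  v≡n : toℕ v ≡ n
  v≡n = toℕ-clamp (ℕ.≤-refl {n})
  u≢v : u ≢ v
  u≢v eq′ = ℕ.<-irrefl (trans (sym u≡1) (trans (cong toℕ eq′) v≡n)) (ℕ.≤-trans (s≤s (s≤s z≤n)) 5≤n′)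

  0u : IsSide V zero u
  0u = ℕ.≤-reflexive (sym u≡1) , corner {zero} (here refl) , corner (there (here u≡1)) , inj₁ split
    where
    split : ∀ z → z ∈ˢ V → z Fin.≤ zero {n} ⊎ u Fin.≤ z
    split zero    _ = inj₁ z≤n
    split (suc z) _ = inj₂ (subst (_≤ suc (toℕ z)) (sym u≡1) (s≤s z≤n))
  0v : IsSide V zero v
  0v = subst (0 ℕ.<_) (sym v≡n) (ℕ.≤-trans (s≤s z≤n) 5≤n′) , corner {zero} (here refl) ,
    corner (there (there (there (here (trans v≡n (sym eq)))))) ,
    inj₂ (λ z _ → z≤n , subst (toℕ z ≤_) (sym v≡n) (ℕ.≤-pred (toℕ<n z)))

  only : ∀ x y → IsSide V x y → IsSide ⊤ x y → (x , y) ≡ (zero , u) ⊎ (x , y) ≡ (zero , v)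
  only x y (_ , x∈ , y∈ , _) side with ⊤-side⁻ side
  ... | inj₂ (x≡0 , y≡n) = inj₂ (cong₂ _,_ (toℕ-injective x≡0) (toℕ-injective (trans y≡n (sym v≡n))))
  ... | inj₁ y≡1+x with ∈-support⁻ (corners 0 rs) x∈ | ∈-support⁻ (corners 0 rs) y∈
  ...   | here x≡0 | _ = inj₁ (cong₂ _,_ (toℕ-injective x≡0)
      (toℕ-injective (trans y≡1+x (trans (cong suc x≡0) (sym u≡1)))))
  ...   | there x∈′ | y∈′ = ⊥-elim (impossible x∈′ (subst (_∈ corners 0 rs) y≡1+x y∈′))
    where
    -- The corners are 0, 1, j, n with 3 ≤ j and j + 2 ≤ n, so 0 and 1 are the only adjacent numbers
    -- among them.
    impossible : ∀ {k} → k ∈ corners 1 (t₁ ∷ t₂ ∷ []) → suc k ∈ corners 0 rs → Empty.⊥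
    impossible (here refl) (there (here ()))
    impossible (here refl) (there (there (here 2≡j))) = ℕ.<⇒≢ 3≤j 2≡j
    impossible (here refl) (there (there (there (here 2≡n)))) =
      ℕ.<⇒≢ (ℕ.≤-trans (s≤s (s≤s (s≤s z≤n))) 5≤n′) (trans 2≡n eq)
    impossible (there (here refl)) (there (here 1+j≡1)) = ℕ.<⇒≢ (ℕ.<-trans (s≤s z≤n) 3≤j)
        (sym (ℕ.suc-injective 1+j≡1))
    impossible (there (here refl)) (there (there (here 1+j≡j))) = ℕ.1+n≢n 1+j≡j
    impossible (there (here refl)) (there (there (there (here 1+j≡n)))) = ℕ.<⇒≢ 2+j≤n (trans 1+j≡n eq)
    impossible (there (there (here refl))) 1+n∈ = ℕ.1+n≰n
      (proj₂ (corners-bounds 0 (leaf ∷ b₁ ∷ b₂ ∷ []) 1+n∈))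

  E : NotchedDissection n
  E = record
    { 5≤n = 5≤n′ ; dissection = D ; quad = V ; quad-piece = piece⇒subpolygon des {root}
        (here refl) ; quad-size = size
    ; quad-unique = unique ; others-3d = multiple
    ; notch = u , v , u≢v , (0u , ⊤-side-suc u≡1) , (0v , ⊤-side-wrap (ℕ.≤-trans (s≤s z≤n) 5≤n′) refl v≡n) , only }

-- From a notched dissection to two trees

Every-from-pieces  : ∀ {P : ℕ → Set} x t → (∀ {o} → o ∈ pieces x t → P (length (proj₂ o))) → Every P t
Every-from-pieces* : ∀ {P : ℕ → Set} x ts → (∀ {o} → o ∈ pieces* x ts → P (length (proj₂ o))) → All (Every P) ts
Every-from-pieces x leaf      h = leaf
Every-from-pieces x (node ts) h = node (h (here refl)) (Every-from-pieces* x ts (λ o∈ → h (there o∈)))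
Every-from-pieces* x []       h = []
Every-from-pieces* x (t ∷ ts) h =
  Every-from-pieces x t (λ o∈ → h (∈-++⁺ˡ o∈)) ∷ Every-from-pieces* (end x t) ts (λ o∈ → h (∈-++⁺ʳ (pieces x t) o∈))

-- The notch puts 0, 1 and n among the corners of the quadrilateral. Containing 0 and n makes it the
-- root, size 4 gives three subtrees, and the corner 1 makes the first of them a leaf.
unnotch : ∀ {n} (E : NotchedDissection n) {rs} → Describes rs (dissection E) →
  ∃[ o ] (o ∈ pieces 0 (node rs) × quad E ≡ vertices (suc n) o) → ∃[ t₁ ] ∃[ t₂ ]
  (Describes (leaf ∷ t₁ ∷ t₂ ∷ []) (dissection E) × Every Ternary t₁ × Every Ternary t₂)
unnotch {n} E {rs} des (o , o∈ , quad≡) = conclude o∈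
  where
  open Describes des
  N = suc n
  bs : All Branching rs
  bs with branching
  ... | node _ bs = bs
  2≤ : 2 ≤ length rs
  2≤ with branching
  ... | node 2≤ _ = 2≤

  apex : ∃[ p ] ∃[ q ] (p ∈ˢ quad E × q ∈ˢ quad E × toℕ p ≡ 1 × toℕ q ≡ n)
  apex with notch E
  ... | u , v , u≢v , ((_ , _ , u∈ , _) , su) , ((_ , _ , v∈ , _) , sv) , _ with ⊤-side⁻ su | ⊤-side⁻ sv
  ... | inj₁ u≡1 | inj₁ v≡1 = ⊥-elim (u≢v (toℕ-injective (trans u≡1 (sym v≡1))))
  ... | inj₁ u≡1 | inj₂ (_ , v≡n) = u , v , u∈ , v∈ , u≡1 , v≡n
  ... | inj₂ (_ , u≡n) | inj₁ v≡1 = v , u , v∈ , u∈ , v≡1 , u≡n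
  ... | inj₂ (_ , u≡n) | inj₂ (_ , v≡n) = ⊥-elim (u≢v (toℕ-injective (trans u≡n (sym v≡n))))

  0∈ : zero ∈ˢ quad E
  0∈ with notch E
  ... | _ , _ , _ , ((_ , z∈ , _) , _) , _ = z∈

  in-corners : ∀ {i : Fin N} → i ∈ˢ quad E → toℕ i ∈ corners (left o) (proj₂ o)
  in-corners i∈ = ∈-support⁻ _ (subst (_ ∈ˢ_) quad≡ i∈)

  0-corner : 0 ∈ corners (left o) (proj₂ o)
  0-corner = in-corners 0∈

  1-corner : 1 ∈ corners (left o) (proj₂ o)
  1-corner with apex
  ... | p , q , p∈ , q∈ , p≡ , q≡ = subst (_∈ _) p≡ (in-corners p∈)

  n-corner : n ∈ corners (left o) (proj₂ o)
  n-corner with apex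
  ... | p , q , p∈ , q∈ , p≡ , q≡ = subst (_∈ _) q≡ (in-corners q∈)

  obs : All Branching (proj₂ o)
  obs = subtrees-Every {t = node rs} 0 branching o∈

  -- A piece starting at vertex 1 or later lacks the corner 0, hence is not the quadrilateral, and
  -- `others-3d` applies.
  others : ∀ {o′} → quad E ≡ vertices N (0 , rs) → o′ ∈ pieces* 0 rs → ¬ (1 ≤ left o′) ⊎ Ternary (length (proj₂ o′))
  others {o′} qe o′∈ with left o′ ℕ.≟ 0
  ... | yes l≡0 = inj₁ (λ 1≤l → ℕ.<⇒≢ 1≤l (sym l≡0))
  ... | no l≢0 = inj₂ (subst (3 ∣_) (∣vertices∣ des (there o′∈))
          (others-3d E _ (piece⇒subpolygon des (there o′∈)) differs))
    where
    differs : vertices N o′ ≢ quad E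
    differs eq = l≢0 (ℕ.n≤0⇒n≡0 (proj₁ (corners-bounds _ (subtrees*-Every 0 bs o′∈)
      (∈-support⁻ _ (subst (zero ∈ˢ_) (sym eq) 0∈)))))

  shape : ∀ us → us ≡ rs → length us ≡ 3 → 1 ∈ corners 0 us → quad E ≡ vertices N (0 , rs) → ∃[ t₁ ] ∃[ t₂ ]
    (Describes (leaf ∷ t₁ ∷ t₂ ∷ []) (dissection E) × Every Ternary t₁ × Every Ternary t₂)
  shape (leaf ∷ t₁ ∷ t₂ ∷ []) refl _ _ qe with bs
  ... | _ ∷ b₁ ∷ b₂ ∷ [] = t₁ , t₂ , des ,
    Every-from-pieces 1 t₁ (λ o′∈ → ternary (proj₁ (pieces-bounds 1 b₁ o′∈)) (∈-++⁺ˡ o′∈)) ,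
    Every-from-pieces (end 1 t₁) t₂ (λ o′∈ → ternary
      (ℕ.≤-trans (ℕ.<⇒≤ (<-end 1 b₁)) (proj₁ (pieces-bounds (end 1 t₁) b₂ o′∈)))
      (∈-++⁺ʳ (pieces 1 t₁) (∈-++⁺ˡ o′∈)))
    where
    ternary : ∀ {o′} → 1 ≤ left o′ → o′ ∈ pieces* 0 (leaf ∷ t₁ ∷ t₂ ∷ []) → Ternary (length (proj₂ o′))
    ternary 1≤l o′∈ with others qe o′∈
    ... | inj₁ ¬1≤l = ⊥-elim (¬1≤l 1≤l)
    ... | inj₂ d    = d
  shape (node us ∷ t₁ ∷ t₂ ∷ []) refl _ (there 1∈) qe with bs
  ... | node 2≤us bus ∷ bs′ = ⊥-elim (ℕ.<⇒≱ (<-end* 0 2≤us bus) (proj₁ (corners-bounds (end* 0 us) bs′ 1∈)))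

  conclude : o ∈ pieces 0 (node rs) → ∃[ t₁ ] ∃[ t₂ ]
    (Describes (leaf ∷ t₁ ∷ t₂ ∷ []) (dissection E) × Every Ternary t₁ × Every Ternary t₂)
  conclude (there o∈′) = ⊥-elim (pieces*-proper 0 2≤ bs o∈′
    (proj₁ (corners-bounds _ obs 0-corner) , ℕ.≤-trans (ℕ.≤-reflexive end≡n)
        (proj₂ (corners-bounds _ obs n-corner))))
  conclude (here refl) = shape rs refl
    (ℕ.suc-injective (trans (sym (∣vertices∣ des {0 , rs} (here refl)))
        (trans (cong ∣_∣ (sym quad≡)) (quad-size E))))
    1-corner quad≡

notched⇒trees : ∀ {n} (E : NotchedDissection n) → ∃[ t₁ ] ∃[ t₂ ]
  (Describes (leaf ∷ t₁ ∷ t₂ ∷ []) (dissection E) × Every Ternary t₁ × Every Ternary t₂)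
notched⇒trees E = unnotch E des (subpolygon⇒piece des (quad-piece E))
  where
  des = proj₂ (describe (ℕ.≤-trans (s≤s (s≤s z≤n)) (5≤n E)) (dissection E))

final-pair : ∀ x t₁ t₂ → final x (word t₁ ++ word t₂) ≡ end (end x t₁) t₂
final-pair x t₁ t₂ = trans (final-++ x (word t₁) (word t₂))
  (trans (cong (λ y → final y (word t₂)) (final-word x t₁)) (final-word (end x t₁) t₂))

Encodes : ∀ {m} → Tree → Tree → Vec ℤ (suc m) → Set
Encodes {m} t₁ t₂ a = end (end 1 t₁) t₂ ≡ suc m ×
  (∀ i → lookup a i ≡ + entry 1 (word t₁ ++ word t₂) (suc (toℕ i)))

solution⇒trees : ∀ {m} (a : Vec ℤ (suc m)) → (∀ i → 0ℤ < lookup a i) → M a ≈ S → ∃[ f ] ∃[ g ]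
  (Every Ternary (node f) × Every Ternary (node g) × Encodes (node f) (node g) a)
solution⇒trees {m} a pos Ma≈S with predecessors a pos
-- The empty innermost forest stands for the `tick` that opens vertex 1; the moves give the rest of
-- the word.
... | k ∷ ks , a≡ with parse [] [] [] [] (moves k ks)
... | g , gs , ag , pend , w≡ with stack-≈Id g gs ag pend
        (≈-trans (inj₁ (cong φ (sym w≡)))
          (≈-trans (≈-sym (M-word (tick ∷ unfold (moves k ks)) 1 m a (moves-final k ks 1)
              (λ i → trans (a≡ i) (cong +_ (sym (moves-entry k ks 1 i))))))
            (≈-trans (·-cong-≈ (≈-refl {S}) Ma≈S) (inj₂ refl))))
... | f , refl , eg , ef = f , g , ef , eg ,
  trans (sym (final-pair 1 (node f) (node g))) (trans (cong (final 1) (sym w≡)) (moves-final k ks 1)) ,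
  λ i → trans (a≡ i) (cong +_ (trans (sym (moves-entry k ks 1 i)) (cong (λ v → entry 1 v (suc (toℕ i))) w≡)))

-- Both trees collapse to `S`, so `S · M a` is S S = ±1; one more factor `S` on the left recovers
-- `M a` up to sign.
trees⇒solution : ∀ {m t₁ t₂} (a : Vec ℤ (suc m)) → Every Ternary t₁ → Every Ternary t₂ → Encodes t₁ t₂ a → M a ≈ S
trees⇒solution {m} {t₁} {t₂} a e₁ e₂ (end≡ , a≡) =
  ≈-trans (≈-sym (inj₂ (S·S· (M a)))) (≈-trans (·-cong-≈ (≈-refl {S}) S·Ma≈Id) (inj₁ (·-identityʳ S)))
  where
  S·Ma≈Id : S · M a ≈ Id
  S·Ma≈Id = ≈-trans (M-word (word t₁ ++ word t₂) 1 m a (trans (final-pair 1 t₁ t₂) end≡) a≡)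
    (≈-trans (inj₁ (φ-++ (word t₁) (word t₂))) (≈-trans (·-cong-≈ (φ-tree e₂) (φ-tree e₁)) (inj₂ refl)))

mainTheorem1 : (n : ℕ) → n ≥ 1 → (a : Vec ℤ n) → (∀ i → 0ℤ < lookup a i) →
    (M a ≡ S ⊎ M a ≡ -ᴹ S) ⇔ (Σ[ E ∈ NotchedDissection n ] IsQuiddityOf a E)
mainTheorem1 (suc m) _ a pos = mk⇔ (λ Ma≈S → to (solution⇒trees a pos Ma≈S))
    (λ { (E , a≡) → from E a≡ (notched⇒trees E) })
  where
  to : ∃[ f ] ∃[ g ] (Every Ternary (node f) × Every Ternary (node g) × Encodes (node f) (node g) a) →
    Σ[ E ∈ NotchedDissection (suc m) ] IsQuiddityOf a E
  to (f , g , ef , eg , end≡ , a≡) = proj₁ E , λ i → trans (a≡ i) (cong +_ (sym (count (suc i))))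
    where
    realized : Σ[ D ∈ Dissection (suc (suc m)) ] Describes (leaf ∷ node f ∷ node g ∷ []) D
    realized = realize (node (s≤s (s≤s z≤n)) (leaf ∷ Every-map ternary⇒2≤ ef ∷ Every-map ternary⇒2≤ eg ∷ [])) end≡
    E = notched (proj₂ realized) ef eg
    count : ∀ i → count3d (dissection (proj₁ E)) i ≡ entry 1 (word* f ++ word* g) (toℕ i)
    count i = count3d≡entry (subst (Describes _) (sym (proj₂ E)) (proj₂ realized)) ef eg i

  from : ∀ (E : NotchedDissection (suc m)) → IsQuiddityOf a E → ∃[ t₁ ] ∃[ t₂ ]
    (Describes (leaf ∷ t₁ ∷ t₂ ∷ []) (dissection E) × Every Ternary t₁ × Every Ternary t₂) → M a ≈ S
  from E a≡ (t₁ , t₂ , des , e₁ , e₂) = trees⇒solution {t₁ = t₁} {t₂} a e₁ e₂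
    (Describes.end≡n des , λ i → trans (a≡ i) (cong +_ (count3d≡entry des e₁ e₂ (suc i))))
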